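{- For every $n\geq 5$ there exist an $n$-dimensional simplex $S\subset\mathbb{R}^n$ with vertices in $\mathbb{Z}^n$ of relative volume $1$ and an infinite sequence $(S_k)_{k\ge 0}$ of pairwise distinct $n$-dimensional simplices with vertices in $\mathbb{Z}^n$ of relative volume $1$ such that, for every $k$, $S\cap S_k$ is a facet of both $S$ and $S_k$, and the $\mathbb{Z}^n$-translates of $S$ and $S_k$ intersect only face-to-face: for every $v\in\mathbb{Z}^n$, the intersection $S\cap(S_k+v)$ is a (possibly empty) common face of $S$ and $S_k+v$.
   Context: The relative volume of an $n$-dimensional simplex in $\mathbb{R}^n$ with vertices in $\mathbb{Z}^n$ is $n!$ times its Euclidean volume (a positive integer). -}

module Defs where

open import Algebra.Bundles using (RawMonoid)
import Algebra.Definitions.RawMonoid as RawMonoidOps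
open import Data.Fin using (Fin)
open import Data.Fin.Subset using (Subset; _∉_; ∣_∣)
import Data.Integer as ℤ
open import Data.Integer using (ℤ; +_)
open import Data.List using (List; foldr)
open import Data.List.Relation.Unary.All using (All)
open import Data.List.Relation.Unary.AllPairs using (AllPairs)
open import Data.Nat as ℕ using (ℕ; suc; _!)
import Data.Nat.Properties as ℕ
open import Data.Product using (∃; _×_; _,_)
import Data.Rational as ℚ
open import Data.Rational using (ℚ; 0ℚ; 1ℚ; ½)
import Data.Rational.Properties as ℚ
open import Data.Rational.Solver using (module +-*-Solver)
open import Data.Vec.Functional using (Vector)
open import Level using (0ℓ)
open import Relation.Binary.PropositionalEquality using (_≡_; refl; sym; trans; cong; subst)
open import Relation.Nullary using (¬_)
open import Relation.Unary using (Pred; _⊆_; _≐_)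

-- Real numbers: Cauchy sequences of rationals, taken up to the
-- equality _≈_ below.

IsCauchy : (ℕ → ℚ) → Set
IsCauchy s = ∀ ε → 0ℚ ℚ.< ε →
  ∃ λ N → ∀ m n → N ℕ.≤ m → N ℕ.≤ n → ℚ.∣ s m ℚ.- s n ∣ ℚ.≤ ε

record ℝ : Set where
  constructor mkℝ
  field
    seq    : ℕ → ℚ
    cauchy : IsCauchy seq

open ℝ public

infix  4 _≤_ _<_ _≈_
infixl 6 _+_
infixr 7 _·_

_≤_ : ℝ → ℝ → Set
x ≤ y = ∀ ε → 0ℚ ℚ.< ε → ∃ λ N → ∀ n → N ℕ.≤ n → seq x n ℚ.≤ seq y n ℚ.+ ε

_≈_ : ℝ → ℝ → Set
x ≈ y = x ≤ y × y ≤ x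

fromℚ : ℚ → ℝ
fromℚ q = mkℝ (λ _ → q) λ ε 0<ε → 0 , λ _ _ _ _ →
  subst (ℚ._≤ ε) (sym (cong ℚ.∣_∣ (ℚ.+-inverseʳ q))) (ℚ.<⇒≤ 0<ε)

0ℝ 1ℝ : ℝ
0ℝ = fromℚ 0ℚ
1ℝ = fromℚ 1ℚ

_+_ : ℝ → ℝ → ℝ
x + y = mkℝ (λ n → seq x n ℚ.+ seq y n) λ ε 0<ε →
  let 0<½ε = subst (ℚ._< ½ ℚ.* ε) (ℚ.*-zeroʳ ½) (ℚ.*-monoʳ-<-pos ½ 0<ε)
      (M , p) = cauchy x (½ ℚ.* ε) 0<½ε
      (N , q) = cauchy y (½ ℚ.* ε) 0<½ε
  in M ℕ.⊔ N , λ m n l k → ℚ.≤-trans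
       (subst (ℚ._≤ ℚ.∣ seq x m ℚ.- seq x n ∣ ℚ.+ ℚ.∣ seq y m ℚ.- seq y n ∣)
         (cong ℚ.∣_∣ (regroup (seq x m) (seq x n) (seq y m) (seq y n)))
         (ℚ.∣p+q∣≤∣p∣+∣q∣ (seq x m ℚ.- seq x n) (seq y m ℚ.- seq y n)))
       (subst (ℚ.∣ seq x m ℚ.- seq x n ∣ ℚ.+ ℚ.∣ seq y m ℚ.- seq y n ∣ ℚ.≤_)
         (halves ε)
         (ℚ.+-mono-≤
           (p m n (ℕ.m⊔n≤o⇒m≤o M N l) (ℕ.m⊔n≤o⇒m≤o M N k))
           (q m n (ℕ.m⊔n≤o⇒n≤o M N l) (ℕ.m⊔n≤o⇒n≤o M N k))))
  where
  regroup : ∀ a b c d → (a ℚ.- b) ℚ.+ (c ℚ.- d) ≡ (a ℚ.+ c) ℚ.- (b ℚ.+ d)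
  regroup = solve 4 (λ a b c d → (a :- b) :+ (c :- d) := (a :+ c) :- (b :+ d)) refl
    where open +-*-Solver
  halves : ∀ ε → ½ ℚ.* ε ℚ.+ ½ ℚ.* ε ≡ ε
  halves ε = trans (sym (ℚ.*-distribʳ-+ ε ½ ½)) (ℚ.*-identityˡ ε)

_·_ : ℚ → ℝ → ℝ
c · x = mkℝ (λ n → c ℚ.* seq x n) λ ε 0<ε →
  let (N , p) = cauchy x (1/d ℚ.* ε)
        (subst (ℚ._< 1/d ℚ.* ε) (ℚ.*-zeroʳ 1/d) (ℚ.*-monoʳ-<-pos 1/d {{1/d>0}} 0<ε))
  in N , λ m n l k → subst (ℚ._≤ ε)
       (sym (trans (cong ℚ.∣_∣ (factor c (seq x m) (seq x n)))
                   (ℚ.∣p*q∣≡∣p∣*∣q∣ c (seq x m ℚ.- seq x n))))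
       (ℚ.≤-trans
         (ℚ.*-monoʳ-≤-nonNeg ℚ.∣ seq x m ℚ.- seq x n ∣
           {{ℚ.∣-∣-nonNeg (seq x m ℚ.- seq x n)}} ∣c∣≤d)
         (subst (d ℚ.* ℚ.∣ seq x m ℚ.- seq x n ∣ ℚ.≤_) (cancel ε)
           (ℚ.*-monoˡ-≤-nonNeg d {{ℚ.pos⇒nonNeg d {{d>0}}}} (p m n l k))))
  where
  d : ℚ
  d = ℚ.∣ c ∣ ℚ.+ 1ℚ
  d>0 : ℚ.Positive d
  d>0 = ℚ.nonNeg+pos⇒pos ℚ.∣ c ∣ {{ℚ.∣-∣-nonNeg c}} 1ℚ
  1/d : ℚ
  1/d = (ℚ.1/ d) {{ℚ.pos⇒nonZero d {{d>0}}}}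
  1/d>0 : ℚ.Positive 1/d
  1/d>0 = ℚ.1/pos⇒pos d {{d>0}}
  ∣c∣≤d : ℚ.∣ c ∣ ℚ.≤ d
  ∣c∣≤d = subst (ℚ._≤ d) (ℚ.+-identityʳ ℚ.∣ c ∣) (ℚ.+-monoʳ-≤ ℚ.∣ c ∣ (ℚ.nonNegative⁻¹ 1ℚ))
  factor : ∀ c a b → c ℚ.* a ℚ.- c ℚ.* b ≡ c ℚ.* (a ℚ.- b)
  factor = solve 3 (λ c a b → c :* a :- c :* b := c :* (a :- b)) refl
    where open +-*-Solver
  cancel : ∀ ε → d ℚ.* (1/d ℚ.* ε) ≡ ε
  cancel ε = trans (sym (ℚ.*-assoc d 1/d ε))
    (trans (cong (ℚ._* ε) (ℚ.*-inverseʳ d {{ℚ.pos⇒nonZero d {{d>0}}}})) (ℚ.*-identityˡ ε))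

_<_ : ℝ → ℝ → Set
x < y = ∃ λ ε → 0ℚ ℚ.< ε × x + fromℚ ε ≤ y

fromℤ : ℤ → ℚ
fromℤ z = z ℚ./ 1

+-0-rawMonoid : RawMonoid 0ℓ 0ℓ
+-0-rawMonoid = record { Carrier = ℝ ; _≈_ = _≈_ ; _∙_ = _+_ ; ε = 0ℝ }

open RawMonoidOps +-0-rawMonoid public using (sum)

Region : ℕ → Set₁
Region n = Pred (Vector ℝ n) 0ℓ

-- Finite families of points of ℤⁿ.

Vertices : ℕ → ℕ → Set
Vertices m n = Vector (Vector ℤ n) m

translate : ∀ {m n} → Vector ℤ n → Vertices m n → Vertices m n
translate v P i j = P i j ℤ.+ v j

combination : ∀ {m n} → Vertices m n → Vector ℝ m → Vector ℝ n
combination P w j = sum (λ i → fromℤ (P i j) · w i)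

AffinelyIndependent : ∀ {m n} → Vertices m n → Set
AffinelyIndependent P = ∀ c → sum c ≈ 0ℝ → (∀ j → combination P c j ≈ 0ℝ) →
  ∀ i → c i ≈ 0ℝ

IsConvexCombination : ∀ {m n} → Vertices m n → Vector ℝ n → Vector ℝ m → Set
IsConvexCombination P x w =
  (∀ i → 0ℝ ≤ w i) × sum w ≈ 1ℝ × (∀ j → combination P w j ≈ x j)

convexHull : ∀ {m n} → Vertices m n → Region n
convexHull P x = ∃ λ w → IsConvexCombination P x w

-- The convex hull of the vertices selected by I; empty when I is empty,
-- since the weights must sum to 1.
face : ∀ {m n} → Vertices m n → Subset m → Region n
face P I x = ∃ λ w → IsConvexCombination P x w × (∀ i → i ∉ I → w i ≈ 0ℝ)

-- IsFace and IsFacet are meant for affinely independent P, where the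
-- faces of the simplex are the hulls of sets of vertices.
IsFace : ∀ {m n} → Vertices m n → Region n → Set
IsFace P A = ∃ λ I → A ≐ face P I

IsFacet : ∀ {m n} → Vertices (suc m) n → Region n → Set
IsFacet {m} P A = ∃ λ I → ∣ I ∣ ≡ m × A ≐ face P I

-- Euclidean volume, as Jordan content.

record Box (n : ℕ) : Set where
  field
    lower upper : Vector ℚ n
    lower≤upper : ∀ j → lower j ℚ.≤ upper j

open Box public

closure interior : ∀ {n} → Box n → Region n
closure  b x = ∀ j → fromℚ (lower b j) ≤ x j × x j ≤ fromℚ (upper b j)
interior b x = ∀ j → fromℚ (lower b j) < x j × x j < fromℚ (upper b j)

-- The library's `sum` taken in the multiplicative monoid, i.e. a product.
boxVolume : ∀ {n} → Box n → ℚ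
boxVolume b = RawMonoidOps.sum ℚ.*-1-rawMonoid (λ j → upper b j ℚ.- lower b j)

totalVolume : ∀ {n} → List (Box n) → ℚ
totalVolume = foldr (λ b q → boxVolume b ℚ.+ q) 0ℚ

InteriorsDisjoint : ∀ {n} → Box n → Box n → Set
InteriorsDisjoint b c = ∀ x → ¬ (interior b x × interior c x)

-- Membership of a real point in a closed box is undecidable, so covering
-- means that no point of A lies outside all the boxes; classically this is
-- the usual notion.
Covers : ∀ {n} → List (Box n) → Region n → Set
Covers bs A = ∀ x → A x → ¬ All (λ b → ¬ closure b x) bs

-- V is both the inner and the outer Jordan content of A.  Packed boxes never
-- have larger total volume than covering ones, so at most one V qualifies.
HasVolume : ∀ {n} → Region n → ℝ → Set
HasVolume {n} A V =
  (∀ ε → 0ℚ ℚ.< ε → ∃ λ (bs : List (Box n)) →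
     All (λ b → closure b ⊆ A) bs × AllPairs InteriorsDisjoint bs ×
     V ≤ fromℚ (totalVolume bs ℚ.+ ε)) ×
  (∀ ε → 0ℚ ℚ.< ε → ∃ λ (bs : List (Box n)) →
     Covers bs A × fromℚ (totalVolume bs) ≤ V + fromℚ ε)

HasRelativeVolume : ∀ {n} → Region n → ℕ → Set
HasRelativeVolume {n} A r =
  ∃ λ V → HasVolume A V × fromℤ (+ (n !)) · V ≈ fromℚ (fromℤ (+ r))

IsUnimodularSimplex : ∀ {n} → Vertices (suc n) n → Set
IsUnimodularSimplex P = AffinelyIndependent P × HasRelativeVolume (convexHull P) 1

{-# OPTIONS --safe #-}
module Submission where

-- Put the common facet F = conv(0, e₁, …, eₘ), m = n - 1, at height 0, the apex
-- of S at (1, 0) and the apex of S_k at (-1, c) with c = (1, 1, 1, k, 0, …, 0).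
-- Only translates by v of height 0, 1 or 2 meet S.  In heights 0 and 2 the
-- intersection is F, a vertex or empty.  In height 1 let w and u be the
-- barycentric coordinates of a common point and s = u₀ = 1 - w₀.  If j and l are
-- two of the three coordinates with c = 1, then wⱼ = uⱼ + s + vⱼ and
-- wₗ = uₗ + s + vₗ, so that vⱼ + vₗ ≥ 0 forces s = 0 because wⱼ + wₗ ≤ s, and
-- vⱼ + vₗ ≤ -2 forces s = 1 because uⱼ + uₗ ≤ 1 - s.  By parity one of the three
-- pairs satisfies one of these conditions, so the point is a vertex of both.
--
-- The simplices have volume 1/n! because their sections at distance t from F
-- are translates of (1 - t) F: cutting into thin slabs, each section is squeezed
-- between corners of nearly equal size, and the polynomials xᵐ / m! telescope.

open import Defs hiding (_≤_; _<_; _≈_; _+_; _·_; sum)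
import Defs as ℝ
open import Algebra.Bundles using (CommutativeRing)
open import Data.Empty using (⊥; ⊥-elim)
open import Data.Fin using (Fin; zero; suc) renaming (_≟_ to _≟ᶠ_)
open import Data.Fin.Patterns using (0F; 1F; 2F; 3F)
open import Data.Fin.Properties using (all?; any?)
open import Data.Fin.Subset using (Subset; _∉_; ⁅_⁆; ⊤; outside) renaming (⊥ to ∅)
open import Data.Fin.Subset.Properties using (∉⊥; x∈⁅x⁆; x∈⁅y⁆⇒x≡y; ∣⊤∣≡n; ∈⊤)
open import Data.Integer as ℤ using (ℤ; +_; -[1+_])
import Data.Integer.Properties as ℤ
open import Data.Integer.Tactic.RingSolver using () renaming (ring to ℤ-ring)
open import Data.List as List using (List; []; _∷_; _++_)
open import Data.List.Relation.Unary.All as All using (All; []; _∷_)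
import Data.List.Relation.Unary.All.Properties as All
open import Data.List.Relation.Unary.AllPairs as AllPairs using (AllPairs; []; _∷_)
import Data.List.Relation.Unary.AllPairs.Properties as AllPairs
open import Data.Nat as ℕ using (ℕ; zero; suc; _≥_; _!)
import Data.Nat.Properties as ℕ
open import Data.Product using (∃; _×_; _,_; proj₁; proj₂)
open import Data.Rational as ℚ using (ℚ; 0ℚ; 1ℚ; ½; _+_; _*_; -_; _-_; _≤_; _<_; toℚᵘ)
import Data.Rational.Properties as ℚ
import Data.Rational.Unnormalised as ℚᵘ
import Data.Rational.Unnormalised.Properties as ℚᵘ
open import Data.Sign as Sign using (Sign)
open import Data.Sum using (_⊎_; inj₁; inj₂)
open import Data.Vec.Base using (_∷_; there)
open import Data.Vec.Functional as Vector using (Vector)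
open import Function using (_∘_)
open import Relation.Binary.PropositionalEquality
open import Relation.Nullary using (¬_; Dec; yes; no; contradiction)
open import Relation.Nullary.Decidable using (dec⇒maybe)
open import Relation.Unary using (_∩_; _≐_)
open import Tactic.RingSolver using (solve-∀)
open import Tactic.RingSolver.Core.AlmostCommutativeRing
  using (AlmostCommutativeRing; fromCommutativeRing)
open import Algebra.Properties.Semiring.Sum (CommutativeRing.semiring ℤ.+-*-commutativeRing)
  using () renaming (sum to sumℤ)
open import Algebra.Properties.Semiring.Sum (CommutativeRing.semiring ℚ.+-*-commutativeRing)
  using (sum; sum-cong-≗; ∑-distrib-+; *-distribˡ-sum)

-- The order of the reals is undecidable here, so no case distinction asks where a point lies: the
-- branches are decided on the integer vector v, and the barycentric weights are then confined by
-- inequalities between limits. Nor is a point asked whether two simplices really meet: once the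
-- common points are confined to one vertex of each, an equality of integer vectors decides between
-- a vertex and the empty face.
--
-- The end of height 1 is integral too. When s is 0 or 1, the differences of the base weights are
-- integers with sum -1 or 1, and an entry of that sign fills the weight of a base vertex of the
-- other simplex.
--
-- Three entries 1 and one free entry k require m at least 4, whence n at least 5. Different k give
-- different hulls because the apex is the only point of height -1.
--
-- For the volumes, the tilt by c makes every corner bound wrong by a multiple of the slab
-- thickness. Near the apex this error exceeds the section, so the inner packing drops a number of
-- slabs there that does not depend on the mesh.

ring : AlmostCommutativeRing _ _
ring = fromCommutativeRing ℚ.+-*-commutativeRing (λ q → dec⇒maybe (0ℚ ℚ.≟ q))

-- Rational arithmetic and the embedding of the integers

p-0≡p : ∀ p → p - 0ℚ ≡ p
p-0≡p = solve-∀ ring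

p+q-p≡q : ∀ p q → p + q - p ≡ q
p+q-p≡q = solve-∀ ring

½p+½p≡p : ∀ p → ½ * p + ½ * p ≡ p
½p+½p≡p = solve-∀ ring

0≤+ : ∀ {p q} → 0ℚ ≤ p → 0ℚ ≤ q → 0ℚ ≤ p + q
0≤+ = ℚ.+-mono-≤

0≤* : ∀ {p q} → 0ℚ ≤ p → 0ℚ ≤ q → 0ℚ ≤ p * q
0≤* {p} {q} 0≤p 0≤q = ℚ.nonNegative⁻¹ (p * q)
  {{ℚ.nonNeg*nonNeg⇒nonNeg p {{ℚ.nonNegative 0≤p}} q {{ℚ.nonNegative 0≤q}}}}

0<* : ∀ {p q} → 0ℚ < p → 0ℚ < q → 0ℚ < p * q
0<* {p} {q} 0<p 0<q = ℚ.positive⁻¹ (p * q)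
  {{ℚ.pos*pos⇒pos p {{ℚ.positive 0<p}} q {{ℚ.positive 0<q}}}}

0≤gap : ∀ {p q} → p ≤ q → 0ℚ ≤ q - p
0≤gap {p} {q} p≤q = subst (_≤ q - p) (ℚ.+-inverseʳ p) (ℚ.+-monoˡ-≤ (- p) p≤q)

≤-gap : ∀ {p q r} → 0ℚ ≤ r → q - p ≡ r → p ≤ q
≤-gap {p} {q} {r} 0≤r eq = subst₂ _≤_ (ℚ.+-identityʳ p) (p+[q-p]≡q p q)
  (ℚ.+-monoʳ-≤ p (subst (0ℚ ≤_) (sym eq) 0≤r))
  where
  p+[q-p]≡q : ∀ p q → p + (q - p) ≡ q
  p+[q-p]≡q = solve-∀ ring

0<½* : ∀ {ε} → 0ℚ < ε → 0ℚ < ½ * ε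
0<½* = 0<* (ℚ.positive⁻¹ ½)

0<1 : 0ℚ < 1ℚ
0<1 = ℚ.positive⁻¹ 1ℚ

1/⁺_ : ∀ {q} → 0ℚ < q → ℚ
1/⁺_ {q} 0<q = (ℚ.1/ q) {{ℚ.pos⇒nonZero q {{ℚ.positive 0<q}}}}

0<1/⁺ : ∀ {q} (0<q : 0ℚ < q) → 0ℚ < 1/⁺ 0<q
0<1/⁺ {q} 0<q = ℚ.positive⁻¹ _ {{ℚ.1/pos⇒pos q {{ℚ.positive 0<q}}}}

*-1/⁺ : ∀ {q} (0<q : 0ℚ < q) → q * (1/⁺ 0<q) ≡ 1ℚ
*-1/⁺ {q} 0<q = ℚ.*-inverseʳ q {{ℚ.pos⇒nonZero q {{ℚ.positive 0<q}}}}

-- `z ℚ./ 1` normalises by a gcd that is stuck on a variable `z`, so the identity is checked on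
-- unnormalised fractions and transported back along `toℚᵘ-injective`.
fromℤ-+ : ∀ a b → fromℤ (a ℤ.+ b) ≡ fromℤ a + fromℤ b
fromℤ-+ a b = ℚ.toℚᵘ-injective (ℚᵘ.≃-trans (ℚ.toℚᵘ-fromℚᵘ (ℚᵘ.mkℚᵘ (a ℤ.+ b) 0))
  (ℚᵘ.≃-sym (ℚᵘ.≃-trans (ℚ.toℚᵘ-homo-+ (fromℤ a) (fromℤ b))
    (ℚᵘ.≃-trans (ℚᵘ.+-cong (ℚ.toℚᵘ-fromℚᵘ (ℚᵘ.mkℚᵘ a 0)) (ℚ.toℚᵘ-fromℚᵘ (ℚᵘ.mkℚᵘ b 0)))
      (ℚᵘ.*≡* (cong (ℤ._* + 1) (cong₂ ℤ._+_ (ℤ.*-identityʳ a) (ℤ.*-identityʳ b))))))))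

fromℤ-* : ∀ a b → fromℤ (a ℤ.* b) ≡ fromℤ a * fromℤ b
fromℤ-* a b = ℚ.toℚᵘ-injective (ℚᵘ.≃-trans (ℚ.toℚᵘ-fromℚᵘ (ℚᵘ.mkℚᵘ (a ℤ.* b) 0))
  (ℚᵘ.≃-sym (ℚᵘ.≃-trans (ℚ.toℚᵘ-homo-* (fromℤ a) (fromℤ b))
    (ℚᵘ.*-cong (ℚ.toℚᵘ-fromℚᵘ (ℚᵘ.mkℚᵘ a 0)) (ℚ.toℚᵘ-fromℚᵘ (ℚᵘ.mkℚᵘ b 0))))))

fromℤ-mono-≤ : ∀ {a b} → a ℤ.≤ b → fromℤ a ≤ fromℤ b
fromℤ-mono-≤ {a} {b} a≤b = ℚ.toℚᵘ-cancel-≤ (ℚᵘ.≤-respˡ-≃ (ℚᵘ.≃-sym (ℚ.toℚᵘ-fromℚᵘ (ℚᵘ.mkℚᵘ a 0)))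
  (ℚᵘ.≤-respʳ-≃ (ℚᵘ.≃-sym (ℚ.toℚᵘ-fromℚᵘ (ℚᵘ.mkℚᵘ b 0))) (ℚᵘ.*≤* (ℤ.*-monoʳ-≤-nonNeg (+ 1) a≤b))))

fromℤ-cancel-≤ : ∀ {a b} → fromℤ a ≤ fromℤ b → a ℤ.≤ b
fromℤ-cancel-≤ {a} {b} a≤b = ℤ.*-cancelʳ-≤-pos a b (+ 1) (ℚᵘ.drop-*≤*
  (ℚᵘ.≤-respˡ-≃ (ℚ.toℚᵘ-fromℚᵘ (ℚᵘ.mkℚᵘ a 0)) (ℚᵘ.≤-respʳ-≃ (ℚ.toℚᵘ-fromℚᵘ (ℚᵘ.mkℚᵘ b 0))
    (ℚ.toℚᵘ-mono-≤ a≤b))))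

fromℤ-neg : ∀ a → fromℤ (ℤ.- a) ≡ - fromℤ a
fromℤ-neg a = ℚ.toℚᵘ-injective (ℚᵘ.≃-trans (ℚ.toℚᵘ-fromℚᵘ (ℚᵘ.mkℚᵘ (ℤ.- a) 0))
  (ℚᵘ.≃-sym (ℚᵘ.≃-trans (ℚ.toℚᵘ-homo‿- (fromℤ a)) (ℚᵘ.-‿cong (ℚ.toℚᵘ-fromℚᵘ (ℚᵘ.mkℚᵘ a 0))))))

-- Sequences of rationals, with the order of their limits

Seq : Set
Seq = ℕ → ℚ

-- Convergence is not part of the condition: sequences can be combined index by index, and
-- identities between reals become `solve-∀` goals over the rationals. The record wrapper keeps `s`
-- inferable.
record Nonneg (s : Seq) : Set where
  constructor nonneg
  field eventually : ∀ ε → 0ℚ < ε → ∃ λ N → ∀ n → N ℕ.≤ n → 0ℚ ≤ s n + ε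

open Nonneg

nonneg-≗ : ∀ {s t} → (∀ n → t n ≡ s n) → Nonneg s → Nonneg t
nonneg-≗ t≗s p = nonneg λ ε 0<ε → let (N , h) = eventually p ε 0<ε in
  N , λ n N≤n → subst (λ q → 0ℚ ≤ q + ε) (sym (t≗s n)) (h n N≤n)

nonneg-pointwise : ∀ {s} → (∀ n → 0ℚ ≤ s n) → Nonneg s
nonneg-pointwise p = nonneg λ ε 0<ε → 0 , λ n _ → 0≤+ (p n) (ℚ.<⇒≤ 0<ε)

nonneg-+ : ∀ {s t} → Nonneg s → Nonneg t → Nonneg (λ n → s n + t n)
nonneg-+ {s} {t} p q = nonneg λ ε 0<ε →
  let (M , f) = eventually p (½ * ε) (0<½* 0<ε)
      (N , g) = eventually q (½ * ε) (0<½* 0<ε)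
  in M ℕ.⊔ N , λ n l → subst (0ℚ ≤_) (halves (s n) (t n) ε)
       (0≤+ (f n (ℕ.m⊔n≤o⇒m≤o M N l)) (g n (ℕ.m⊔n≤o⇒n≤o M N l)))
  where
  halves : ∀ a b ε → (a + ½ * ε) + (b + ½ * ε) ≡ a + b + ε
  halves = solve-∀ ring

nonneg-* : ∀ {s q} → 0ℚ ≤ q → Nonneg s → Nonneg (λ n → q * s n)
nonneg-* {s} {q} 0≤q p = nonneg λ ε 0<ε →
  -- The tolerance is ε/(1+q) rather than ε/q, so that q = 0 is not a separate case; one more
  -- ε/(1+q) completes q·ε/(1+q) to ε.
  let (N , h) = eventually p (r * ε) (0<* (0<1/⁺ 0<1+q) 0<ε)
  in N , λ n N≤n → subst (0ℚ ≤_) (split (s n) ε)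
    (0≤+ (0≤* 0≤q (h n N≤n)) (ℚ.<⇒≤ (0<* (0<1/⁺ 0<1+q) 0<ε)))
  where
  0<1+q : 0ℚ < 1ℚ + q
  0<1+q = ℚ.+-mono-<-≤ 0<1 0≤q
  r : ℚ
  r = 1/⁺ 0<1+q
  regroup : ∀ q a r ε → q * (a + r * ε) + r * ε ≡ q * a + ((1ℚ + q) * r) * ε
  regroup = solve-∀ ring
  split : ∀ a ε → q * (a + r * ε) + r * ε ≡ q * a + ε
  split a ε = trans (regroup q a r ε)
    (cong (λ x → q * a + x) (trans (cong (_* ε) (*-1/⁺ 0<1+q)) (ℚ.*-identityˡ ε)))

nonneg-const : ∀ {q} → Nonneg (λ _ → q) → 0ℚ ≤ q
nonneg-const {q} p = ℚ.≮⇒≥ λ q<0 →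
  let 0<-q = ℚ.neg-antimono-< q<0
      (N , h) = eventually p (½ * (- q)) (0<½* 0<-q)
  in ℚ.<-irrefl refl (ℚ.<-≤-trans (0<½* 0<-q)
       (≤-gap (h N ℕ.≤-refl) (halve q)))
  where
  halve : ∀ q → 0ℚ - ½ * (- q) ≡ q + ½ * (- q)
  halve = solve-∀ ring

nonneg-sum : ∀ {m} {s : Fin m → Seq} → (∀ i → Nonneg (s i)) → Nonneg (λ n → sum (λ i → s i n))
nonneg-sum {zero}  p = nonneg-pointwise (λ _ → ℚ.≤-refl)
nonneg-sum {suc m} p = nonneg-+ (p zero) (nonneg-sum (p ∘ suc))

record Null (s : Seq) : Set where
  constructor null
  field
    null-≥ : Nonneg s
    null-≤ : Nonneg (λ n → - s n)

open Null

null-≗ : ∀ {s t} → (∀ n → t n ≡ s n) → Null s → Null t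
null-≗ e (null p q) = null (nonneg-≗ e p) (nonneg-≗ (cong -_ ∘ e) q)

null-0 : Null (λ _ → 0ℚ)
null-0 = null (nonneg-pointwise (λ _ → ℚ.≤-refl)) (nonneg-pointwise (λ _ → ℚ.≤-refl))

null-neg : ∀ {s} → Null s → Null (λ n → - s n)
null-neg {s} (null p q) = null q (nonneg-≗ (λ n → involutive (s n)) p)
  where
  involutive : ∀ a → - (- a) ≡ a
  involutive = solve-∀ ring

null-+ : ∀ {s t} → Null s → Null t → Null (λ n → s n + t n)
null-+ {s} {t} (null p q) (null p′ q′) =
  null (nonneg-+ p p′) (nonneg-≗ (λ n → ℚ.neg-distrib-+ (s n) (t n)) (nonneg-+ q q′))

null-* : ∀ {s} q → Null s → Null (λ n → q * s n)
null-* {s} q (null p p′) with ℚ.≤-total 0ℚ q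
... | inj₁ 0≤q = null (nonneg-* 0≤q p)
        (nonneg-≗ (λ n → ℚ.neg-distribʳ-* q (s n)) (nonneg-* 0≤q p′))
... | inj₂ q≤0 = let 0≤-q = ℚ.neg-antimono-≤ q≤0 in
        null (nonneg-≗ (λ n → neg² q (s n)) (nonneg-* 0≤-q p′))
          (nonneg-≗ (λ n → ℚ.neg-distribˡ-* q (s n)) (nonneg-* 0≤-q p))
  where
  neg² : ∀ q a → q * a ≡ - q * - a
  neg² = solve-∀ ring

null-sum : ∀ {m} {s : Fin m → Seq} → (∀ i → Null (s i)) → Null (λ n → sum (λ i → s i n))
null-sum {zero}  p = null-0
null-sum {suc m} p = null-+ (p zero) (null-sum (p ∘ suc))

≤⇒nonneg : ∀ {x y} → x ℝ.≤ y → Nonneg (λ n → seq y n - seq x n)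
≤⇒nonneg {x} {y} x≤y = nonneg λ ε 0<ε → let (N , h) = x≤y ε 0<ε in
  N , λ n N≤n → subst (0ℚ ≤_) (regroup (seq x n) (seq y n) ε) (0≤gap (h n N≤n))
  where
  regroup : ∀ a b ε → (b + ε) - a ≡ b - a + ε
  regroup = solve-∀ ring

nonneg⇒≤ : ∀ {x y} → Nonneg (λ n → seq y n - seq x n) → x ℝ.≤ y
nonneg⇒≤ {x} {y} p ε 0<ε = let (N , h) = eventually p ε 0<ε in
  N , λ n N≤n → ≤-gap (h n N≤n) (regroup (seq x n) (seq y n) ε)
  where
  regroup : ∀ a b ε → (b + ε) - a ≡ b - a + ε
  regroup = solve-∀ ring

private
  flip-gap : ∀ a b → b - a ≡ - (a - b)
  flip-gap = solve-∀ ring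

≈⇒null : ∀ {x y} → x ℝ.≈ y → Null (λ n → seq x n - seq y n)
≈⇒null {x} {y} (x≤y , y≤x) = null (≤⇒nonneg {y} {x} y≤x)
  (nonneg-≗ (λ n → sym (flip-gap (seq x n) (seq y n))) (≤⇒nonneg {x} {y} x≤y))

null⇒≈ : ∀ {x y} → Null (λ n → seq x n - seq y n) → x ℝ.≈ y
null⇒≈ {x} {y} (null p q) =
  nonneg⇒≤ {x} {y} (nonneg-≗ (λ n → flip-gap (seq x n) (seq y n)) q) , nonneg⇒≤ {y} {x} p

fromℚ-mono-≤ : ∀ {p q} → p ≤ q → fromℚ p ℝ.≤ fromℚ q
fromℚ-mono-≤ {p} {q} p≤q = nonneg⇒≤ {fromℚ p} {fromℚ q} (nonneg-pointwise (λ _ → 0≤gap p≤q))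

-- The constructive substitute for a total order, and the one place that uses the Cauchy condition:
-- from some N on the terms stay within ε/2 of term N, so comparing that single rational with q +
-- ε/2 either gives the bound or makes x ≥ q.
nonneg-or-nonpos : ∀ x q → ¬ Nonneg (λ n → seq x n - q) → Nonneg (λ n → q - seq x n)
nonneg-or-nonpos x q ¬p = nonneg λ ε 0<ε →
  let (N , h) = cauchy x (½ * ε) (0<½* 0<ε) in N , bound N h
  where
  abs-lower : ∀ a b {δ} → ℚ.∣ a - b ∣ ≤ δ → 0ℚ ≤ δ - (a - b)
  abs-lower a b le = 0≤gap (ℚ.≤-trans (p≤∣p∣ (a - b)) le)
    where
    p≤∣p∣ : ∀ p → p ≤ ℚ.∣ p ∣
    p≤∣p∣ p with ℚ.≤-total 0ℚ p
    ... | inj₁ 0≤p = ℚ.≤-reflexive (sym (ℚ.0≤p⇒∣p∣≡p 0≤p))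
    ... | inj₂ p≤0 = ℚ.≤-trans p≤0 (ℚ.0≤∣p∣ p)
  split₁ : ∀ a b q e → q - a + e ≡ (½ * e - (a - b)) + ((q + ½ * e) - b)
  split₁ = solve-∀ ring
  split₂ : ∀ a b q e → b - q ≡ (½ * e - (a - b)) + (a - (q + ½ * e))
  split₂ = solve-∀ ring
  bound : ∀ {ε} N → (∀ m n → N ℕ.≤ m → N ℕ.≤ n → ℚ.∣ seq x m - seq x n ∣ ≤ ½ * ε) →
    ∀ n → N ℕ.≤ n → 0ℚ ≤ q - seq x n + ε
  bound {ε} N h n N≤n with ℚ.≤-total (seq x N) (q + ½ * ε)
  ... | inj₁ le = subst (0ℚ ≤_) (sym (split₁ (seq x n) (seq x N) q ε))
          (0≤+ (abs-lower (seq x n) (seq x N) (h n N N≤n ℕ.≤-refl)) (0≤gap le))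
  ... | inj₂ ge = contradiction (nonneg λ δ 0<δ → N , λ k N≤k → 0≤+
          (subst (0ℚ ≤_) (sym (split₂ (seq x N) (seq x k) q ε))
            (0≤+ (abs-lower (seq x N) (seq x k) (h N k ℕ.≤-refl N≤k)) (0≤gap ge)))
          (ℚ.<⇒≤ 0<δ)) ¬p

seq-sum : ∀ {m} (w : Vector ℝ m) n → seq (ℝ.sum w) n ≡ sum (λ i → seq (w i) n)
seq-sum {zero}  w n = refl
seq-sum {suc m} w n = cong (_+_ (seq (w zero) n)) (seq-sum (w ∘ suc) n)

seq-combination : ∀ {m k} (P : Vertices m k) w j n →
  seq (combination P w j) n ≡ sum (λ i → fromℤ (P i j) * seq (w i) n)
seq-combination P w j = seq-sum (λ i → fromℤ (P i j) ℝ.· w i)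

-- Convex combinations

nonneg-term : ∀ {m} {s : Fin m → Seq} → (∀ i → Nonneg (s i)) → ∀ i →
  Nonneg (λ n → sum (λ k → s k n) - s i n)
nonneg-term {s = s} p zero = nonneg-≗ (λ n → p+q-p≡q (s zero n) _) (nonneg-sum (p ∘ suc))
nonneg-term {s = s} p (suc i) =
  nonneg-≗ (λ n → regroup (s zero n) _ (s (suc i) n)) (nonneg-+ (p zero) (nonneg-term (p ∘ suc) i))
  where
  regroup : ∀ a b c → a + b - c ≡ a + (b - c)
  regroup = solve-∀ ring

nonneg-pair : ∀ {m} {s : Fin m → Seq} → (∀ i → Nonneg (s i)) → ∀ {i j} → i ≢ j →
  Nonneg (λ n → sum (λ k → s k n) - (s i n + s j n))
nonneg-pair {s = s} p {zero}  {zero}  i≢j = contradiction refl i≢j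
nonneg-pair {s = s} p {zero}  {suc j} i≢j =
  nonneg-≗ (λ n → drop (s zero n) _ (s (suc j) n)) (nonneg-term (p ∘ suc) j)
  where
  drop : ∀ a b c → a + b - (a + c) ≡ b - c
  drop = solve-∀ ring
nonneg-pair {s = s} p {suc i} {zero}  i≢j =
  nonneg-≗ (λ n → drop (s zero n) _ (s (suc i) n)) (nonneg-term (p ∘ suc) i)
  where
  drop : ∀ a b c → a + b - (c + a) ≡ b - c
  drop = solve-∀ ring
nonneg-pair {s = s} p {suc i} {suc j} i≢j =
  nonneg-≗ (λ n → regroup (s zero n) _ (s (suc i) n) (s (suc j) n))
    (nonneg-+ (p zero) (nonneg-pair (p ∘ suc) (i≢j ∘ cong suc)))
  where
  regroup : ∀ a b c d → a + b - (c + d) ≡ a + (b - (c + d))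
  regroup = solve-∀ ring

sum-shift : ∀ {m} (a : Fin m → ℚ) b (w : Fin m → ℚ) →
  sum (λ k → (a k - b) * w k) ≡ sum (λ k → a k * w k) - b * sum w
sum-shift {zero}  a b w = zeros b
  where
  zeros : ∀ b → 0ℚ ≡ 0ℚ - b * 0ℚ
  zeros = solve-∀ ring
sum-shift {suc m} a b w = trans (cong (_+_ ((a zero - b) * w zero)) (sum-shift (a ∘ suc) b (w ∘ suc)))
  (regroup (a zero) b (w zero) _ _)
  where
  regroup : ∀ a b w s t → (a - b) * w + (s - b * t) ≡ a * w + s - b * (w + t)
  regroup = solve-∀ ring

sum-minus : ∀ {k} (a b : Fin k → ℚ) → sum (λ j → a j - b j) ≡ sum a - sum b
sum-minus {zero}  a b = refl
sum-minus {suc k} a b = trans (cong (_+_ (a zero - b zero)) (sum-minus (a ∘ suc) (b ∘ suc)))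
  (regroup (a zero) (b zero) (sum (a ∘ suc)) (sum (b ∘ suc)))
  where
  regroup : ∀ a b s t → a - b + (s - t) ≡ a + s - (b + t)
  regroup = solve-∀ ring

basis : ∀ {m} → Fin m → Vector ℤ m
basis zero    zero    = + 1
basis zero    (suc j) = + 0
basis (suc i) zero    = + 0
basis (suc i) (suc j) = basis i j

sum-0* : ∀ {m} (a : Fin m → ℚ) → sum (λ k → 0ℚ * a k) ≡ 0ℚ
sum-0* {zero}  a = refl
sum-0* {suc m} a = cong₂ _+_ (ℚ.*-zeroˡ (a zero)) (sum-0* (a ∘ suc))

sum-basis : ∀ {m} (i : Fin m) (a : Fin m → ℚ) → sum (λ k → fromℤ (basis i k) * a k) ≡ a i
sum-basis zero    a = trans (cong₂ _+_ (ℚ.*-identityˡ (a zero)) (sum-0* (a ∘ suc)))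
  (ℚ.+-identityʳ (a zero))
sum-basis (suc i) a = trans (cong₂ _+_ (ℚ.*-zeroˡ (a zero)) (sum-basis i (a ∘ suc)))
  (ℚ.+-identityˡ (a (suc i)))

basis-nonneg : ∀ {m} (i k : Fin m) → 0ℚ ≤ fromℤ (basis i k)
basis-nonneg zero    zero    = ℚ.nonNegative⁻¹ 1ℚ
basis-nonneg zero    (suc k) = ℚ.≤-refl
basis-nonneg (suc i) zero    = ℚ.≤-refl
basis-nonneg (suc i) (suc k) = basis-nonneg i k

Σʷ : ∀ {m} → Vector ℝ m → Seq
Σʷ w n = sum (λ i → seq (w i) n)

Σᵖ : ∀ {m n} → Vertices m n → Vector ℝ m → Fin n → Seq
Σᵖ P w j n = sum (λ i → fromℤ (P i j) * seq (w i) n)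

record Weights {m n} (P : Vertices m n) (x : Vector ℝ n) (w : Vector ℝ m) : Set where
  field
    weight≥0 : ∀ i → Nonneg (seq (w i))
    total    : Null (λ n → Σʷ w n - 1ℚ)
    point    : ∀ j → Null (λ n → Σᵖ P w j n - seq (x j) n)

open Weights

≈0⇒null : ∀ {x} → x ℝ.≈ 0ℝ → Null (seq x)
≈0⇒null {x} x≈0 = null-≗ (λ n → sym (p-0≡p (seq x n))) (≈⇒null {x} {0ℝ} x≈0)

null⇒≈0 : ∀ {x} → Null (seq x) → x ℝ.≈ 0ℝ
null⇒≈0 {x} p = null⇒≈ {x} {0ℝ} (null-≗ (λ n → p-0≡p (seq x n)) p)

module _ {m n : ℕ} (P : Vertices m n) (x : Vector ℝ n) (w : Vector ℝ m) where

  weights : IsConvexCombination P x w → Weights P x w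
  weights (w≥0 , Σw≈1 , Pw≈x) = record
    { weight≥0 = λ i → nonneg-≗ (λ n → sym (p-0≡p (seq (w i) n))) (≤⇒nonneg {0ℝ} {w i} (w≥0 i))
    ; total    = null-≗ (λ n → cong (_- 1ℚ) (sym (seq-sum w n))) (≈⇒null {ℝ.sum w} {1ℝ} Σw≈1)
    ; point    = λ j → null-≗ (λ n → cong (_- seq (x j) n) (sym (seq-combination P w j n)))
                   (≈⇒null {combination P w j} {x j} (Pw≈x j))
    }

  convexCombination : Weights P x w → IsConvexCombination P x w
  convexCombination W =
    (λ i → nonneg⇒≤ {0ℝ} {w i} (nonneg-≗ (λ n → p-0≡p (seq (w i) n)) (weight≥0 W i))) ,
    null⇒≈ {ℝ.sum w} {1ℝ} (null-≗ (λ n → cong (_- 1ℚ) (seq-sum w n)) (total W)) ,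
    λ j → null⇒≈ {combination P w j} {x j}
      (null-≗ (λ n → cong (_- seq (x j) n) (seq-combination P w j n)) (point W j))

[p-p]*q≡0 : ∀ p q → (p - p) * q ≡ 0ℚ
[p-p]*q≡0 = solve-∀ ring

unit : ∀ {m} → Fin m → Vector ℝ m
unit i k = fromℚ (fromℤ (basis i k))

module _ {m n : ℕ} {P : Vertices m n} {x : Vector ℝ n} where

  -- The bound on pairs gives wₖ + wᵢ ≤ 1, so wᵢ ≥ 1 leaves nothing for wₖ.
  others-null : ∀ {w} → Weights P x w → ∀ {i} → Nonneg (λ n → seq (w i) n - 1ℚ) →
    ∀ {k} → k ≢ i → Null (seq (w k))
  others-null {w} W {i} wᵢ≥1 {k} k≢i = null (weight≥0 W k)
    (nonneg-≗ (λ n → regroup (seq (w i) n) (seq (w k) n) (Σʷ w n))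
      (nonneg-+ (nonneg-+ (nonneg-pair (weight≥0 W) k≢i) wᵢ≥1) (null-≤ (total W))))
    where
    regroup : ∀ a b s → - b ≡ (s - (b + a)) + (a - 1ℚ) + - (s - 1ℚ)
    regroup = solve-∀ ring

  -- Measured from Pᵢ, the point is the sum of the (Pₖ - Pᵢ) wₖ. The i-th term vanishes by its
  -- factor, the others by their weights.
  at-vertex : ∀ {w} → Weights P x w → ∀ {i} → (∀ {k} → k ≢ i → Null (seq (w k))) →
    ∀ j → Null (λ n → fromℤ (P i j) - seq (x j) n)
  at-vertex {w} W {i} wₖ≈0 j = null-≗
    (λ n → trans (regroup (fromℤ (P i j)) (seq (x j) n) (Σᵖ P w j n) (Σʷ w n))
      (cong (λ t → (Σᵖ P w j n - seq (x j) n) + - t + - fromℤ (P i j) * (Σʷ w n - 1ℚ))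
        (sym (sum-shift (λ k → fromℤ (P k j)) (fromℤ (P i j)) (λ k → seq (w k) n)))))
    (null-+ (null-+ (point W j) (null-neg (null-sum terms))) (null-* (- fromℤ (P i j)) (total W)))
    where
    regroup : ∀ p x s t → p - x ≡ (s - x) + - (s - p * t) + - p * (t - 1ℚ)
    regroup = solve-∀ ring
    terms : ∀ k → Null (λ n → (fromℤ (P k j) - fromℤ (P i j)) * seq (w k) n)
    terms k with k ≟ᶠ i
    ... | yes refl = null-≗ (λ n → [p-p]*q≡0 (fromℤ (P k j)) (seq (w k) n)) null-0
    ... | no k≢i   = null-* (fromℤ (P k j) - fromℤ (P i j)) (wₖ≈0 k≢i)

  unit-weights : ∀ i → (∀ j → Null (λ n → fromℤ (P i j) - seq (x j) n)) → Weights P x (unit i)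
  unit-weights i Pᵢ≈x = record
    { weight≥0 = λ k → nonneg-pointwise (λ _ → basis-nonneg i k)
    ; total    = null-≗ (λ _ → trans (cong (_- 1ℚ) sum-unit) (ℚ.+-inverseʳ 1ℚ)) null-0
    ; point    = λ j → null-≗ (λ n → cong (_- seq (x j) n)
        (trans (sum-cong-≗ (λ k → ℚ.*-comm (fromℤ (P k j)) (fromℤ (basis i k))))
          (sum-basis i (λ k → fromℤ (P k j))))) (Pᵢ≈x j)
    }
    where
    sum-unit : sum (λ k → fromℤ (basis i k)) ≡ 1ℚ
    sum-unit = trans (sum-cong-≗ (λ k → sym (ℚ.*-identityʳ (fromℤ (basis i k)))))
      (sum-basis i (λ _ → 1ℚ))

  -- A vertex of weight 0 may be moved freely. This carries weights on the common base from one cone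
  -- to the other, and also removes a translation by 0.
  unchanged-weights : ∀ {Q : Vertices m n} {w} → (∀ i j → P i j ≡ Q i j ⊎ Null (seq (w i))) →
    Weights P x w → Weights Q x w
  unchanged-weights {Q} {w} same W = record
    { weight≥0 = weight≥0 W
    ; total    = total W
    ; point    = λ j → null-≗
        (λ n → trans (regroup (Σᵖ Q w j n) (Σᵖ P w j n) (seq (x j) n))
          (cong (_+ (Σᵖ P w j n - seq (x j) n)) (sym (sum-gap j n))))
        (null-+ (null-sum (λ i → term i j)) (point W j))
    }
    where
    regroup : ∀ s t x → s - x ≡ (s + - t) + (t - x)
    regroup = solve-∀ ring
    distrib : ∀ a b w → (a - b) * w ≡ a * w - b * w
    distrib = solve-∀ ring
    sum-gap : ∀ j n → sum (λ i → (fromℤ (Q i j) - fromℤ (P i j)) * seq (w i) n) ≡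
      Σᵖ Q w j n - Σᵖ P w j n
    sum-gap j n =
      trans (sum-cong-≗ (λ i → distrib (fromℤ (Q i j)) (fromℤ (P i j)) (seq (w i) n)))
        (sum-minus (λ i → fromℤ (Q i j) * seq (w i) n) (λ i → fromℤ (P i j) * seq (w i) n))
    term : ∀ i j → Null (λ n → (fromℤ (Q i j) - fromℤ (P i j)) * seq (w i) n)
    term i j with same i j
    ... | inj₁ eq   = null-≗ (λ n → trans (cong (λ z → (fromℤ (Q i j) - fromℤ z) * seq (w i) n) eq)
                        ([p-p]*q≡0 (fromℤ (Q i j)) (seq (w i) n))) null-0
    ... | inj₂ w≈0 = null-* (fromℤ (Q i j) - fromℤ (P i j)) w≈0

null-const-ℤ : ∀ {a b} → Null (λ _ → fromℤ a - fromℤ b) → a ≡ b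
null-const-ℤ {a} {b} (null p q) = ℤ.≤-antisym
  (fromℤ-cancel-≤ (≤-gap (nonneg-const q) (flip (fromℤ a) (fromℤ b))))
  (fromℤ-cancel-≤ (≤-gap (nonneg-const p) refl))
  where
  flip : ∀ a b → b - a ≡ - (a - b)
  flip = solve-∀ ring

same-vertex : ∀ {a b} {s : Seq} → Null (λ n → fromℤ a - s n) → Null (λ n → fromℤ b - s n) → a ≡ b
same-vertex {a} {b} {s} p q = null-const-ℤ
  (null-≗ (λ n → regroup (fromℤ a) (fromℤ b) (s n)) (null-+ p (null-neg q)))
  where
  regroup : ∀ a b s → a - b ≡ (a - s) + - (b - s)
  regroup = solve-∀ ring

-- Common faces

¬nonneg--1 : ¬ Nonneg (λ _ → - 1ℚ)
¬nonneg--1 p = ℚ.<-irrefl refl (ℚ.<-≤-trans (ℚ.negative⁻¹ (- 1ℚ)) (nonneg-const p))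

BothFaces BothFacets : ∀ {m n} → Vertices (suc m) n → Vertices (suc m) n → Set
BothFaces  P Q = IsFace P (convexHull P ∩ convexHull Q) × IsFace Q (convexHull P ∩ convexHull Q)
BothFacets P Q = IsFacet P (convexHull P ∩ convexHull Q) × IsFacet Q (convexHull P ∩ convexHull Q)

facets⇒faces : ∀ {m n} {P Q : Vertices (suc m) n} → BothFacets P Q → BothFaces P Q
facets⇒faces ((I , _ , p) , (J , _ , q)) = (I , p) , (J , q)

≐-intro : ∀ {n} {A B : Region n} → (∀ x → A x → B x) → (∀ x → B x → A x) → A ≐ B
≐-intro to from = (λ {x} → to x) , (λ {x} → from x)

∩-swap : ∀ {n} (A B C : Region n) → A ∩ B ≐ C → B ∩ A ≐ C
∩-swap A B C (to , from) = ≐-intro (λ x p → to {x} (proj₂ p , proj₁ p))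
  (λ x c → proj₂ (from {x} c) , proj₁ (from {x} c))

module _ {m n : ℕ} (P Q : Vertices (suc m) n) where

  -- The empty set is the face without vertices: all weights would be null there, against their
  -- total 1.
  meet-nowhere : (∀ {x w u} → Weights P x w → Weights Q x u → ⊥) → BothFaces P Q
  meet-nowhere absurd = (∅ , ≐-intro (to P) (from P)) , (∅ , ≐-intro (to Q) (from Q))
    where
    to : ∀ (R : Vertices (suc m) n) x → (convexHull P ∩ convexHull Q) x → face R ∅ x
    to R x ((w , c) , (u , d)) = ⊥-elim (absurd (weights P x w c) (weights Q x u d))
    from : ∀ (R : Vertices (suc m) n) x → face R ∅ x → (convexHull P ∩ convexHull Q) x
    from R x (w , c , w≈0) = ⊥-elim (¬nonneg--1 (nonneg-≗ (λ n → regroup (Σʷ w n))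
      (nonneg-+ (null-≥ (total (weights R x w c))) (null-≤ w≈0′))))
      where
      regroup : ∀ s → - 1ℚ ≡ (s - 1ℚ) + - s
      regroup = solve-∀ ring
      w≈0′ : Null (Σʷ w)
      w≈0′ = null-sum (λ i → ≈0⇒null {w i} (w≈0 i ∉⊥))

  vertex-face : ∀ {i j} → (∀ k → P i k ≡ Q j k) →
    (∀ {x w u} → Weights P x w → Weights Q x u → Nonneg (λ n → seq (w i) n - 1ℚ)) →
    convexHull P ∩ convexHull Q ≐ face P ⁅ i ⁆
  vertex-face {i} {j} P≡Q near = ≐-intro to from
    where
    to : ∀ x → (convexHull P ∩ convexHull Q) x → face P ⁅ i ⁆ x
    to x ((w , c) , (u , d)) = w , c , λ k k∉ → null⇒≈0 {w k}
      (others-null W (near W (weights Q x u d)) λ { refl → k∉ (x∈⁅x⁆ i) })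
      where W = weights P x w c
    from : ∀ x → face P ⁅ i ⁆ x → (convexHull P ∩ convexHull Q) x
    from x (w , c , w≈0) = (w , c) , unit j , convexCombination Q x (unit j) (unit-weights j λ k →
      subst (λ z → Null (λ n → fromℤ z - seq (x k) n)) (P≡Q k)
        (at-vertex (weights P x w c) (λ {l} l≢i → ≈0⇒null {w l} (w≈0 l (l≢i ∘ x∈⁅y⁆⇒x≡y i))) k))

  base : Subset (suc m)
  base = outside ∷ ⊤

  -- Weights with a null apex entry represent the same point in P and in Q, so a point of the base
  -- lies in both hulls with the weights it already has.
  base-face : (∀ i j → P (suc i) j ≡ Q (suc i) j) →
    (∀ {x w u} → Weights P x w → Weights Q x u → Null (seq (w zero))) →
    convexHull P ∩ convexHull Q ≐ face P base
  base-face P≡Q flat = ≐-intro to from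
    where
    to : ∀ x → (convexHull P ∩ convexHull Q) x → face P base x
    to x ((w , c) , (u , d)) = w , c , λ
      { zero    _  → null⇒≈0 {w zero} (flat (weights P x w c) (weights Q x u d))
      ; (suc i) i∉ → contradiction (there ∈⊤) i∉ }
    from : ∀ x → face P base x → (convexHull P ∩ convexHull Q) x
    from x (w , c , w≈0) = (w , c) , w , convexCombination Q x w (unchanged-weights same (weights P x w c))
      where
      same : ∀ i j → P i j ≡ Q i j ⊎ Null (seq (w i))
      same zero    j = inj₂ (≈0⇒null {w zero} (w≈0 zero λ ()))
      same (suc i) j = inj₁ (P≡Q i j)

module _ {m n : ℕ} (P Q : Vertices (suc m) n) where

  -- Any common point must be both Pᵢ and Qⱼ. Whether these agree is decided on integer coordinates:
  -- if they do, the intersection is that vertex, otherwise it is empty.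
  meet-in-vertex : ∀ i j →
    (∀ {x w u} → Weights P x w → Weights Q x u →
      Nonneg (λ n → seq (w i) n - 1ℚ) × Nonneg (λ n → seq (u j) n - 1ℚ)) →
    BothFaces P Q
  meet-in-vertex i j near = decide (all? (λ k → P i k ℤ.≟ Q j k))
    where
    decide : Dec (∀ k → P i k ≡ Q j k) → BothFaces P Q
    decide (no P≢Q) = meet-nowhere P Q λ {x} W U → P≢Q λ k →
      same-vertex {P i k} {Q j k} {seq (x k)}
        (at-vertex W (others-null W (proj₁ (near W U))) k)
        (at-vertex U (others-null U (proj₂ (near W U))) k)
    decide (yes P≡Q) =
      (⁅ i ⁆ , vertex-face P Q P≡Q (λ W U → proj₁ (near W U))) ,
      (⁅ j ⁆ , ∩-swap (convexHull Q) (convexHull P) (face Q ⁅ j ⁆)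
        (vertex-face Q P (sym ∘ P≡Q) (λ U W → proj₂ (near W U))))

  meet-in-base : (∀ i j → P (suc i) j ≡ Q (suc i) j) →
    (∀ {x w u} → Weights P x w → Weights Q x u → Null (seq (w zero)) × Null (seq (u zero))) →
    BothFacets P Q
  meet-in-base P≡Q flat =
    (base P Q , ∣⊤∣≡n m , base-face P Q P≡Q (λ W U → proj₁ (flat W U))) ,
    (base Q P , ∣⊤∣≡n m ,
      ∩-swap (convexHull Q) (convexHull P) (face Q (base Q P))
        (base-face Q P (λ i j → sym (P≡Q i j)) (λ U W → proj₂ (flat W U))))

-- The simplices

corner : ∀ {m} → Vertices (suc m) m
corner zero    j = + 0
corner (suc i) j = basis i j

-- Coordinate `zero` is the height. Vertex `zero` is the apex, `suc zero` the origin, and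
-- `suc (suc j)` the basis vector that alone with the apex contributes to coordinate `suc j`.
cone : ∀ {m} → ℤ → Vector ℤ m → Vertices (suc (suc m)) (suc m)
cone h c zero    zero    = h
cone h c zero    (suc j) = c j
cone h c (suc i) zero    = + 0
cone h c (suc i) (suc j) = corner i j

basis-sym : ∀ {m} (i j : Fin m) → basis i j ≡ basis j i
basis-sym zero    zero    = refl
basis-sym zero    (suc j) = refl
basis-sym (suc i) zero    = refl
basis-sym (suc i) (suc j) = basis-sym i j

cone-height : ∀ {m} h (c : Vector ℤ m) w n → Σᵖ (cone h c) w zero n ≡ fromℤ h * seq (w zero) n
cone-height h c w n = trans (cong (_+_ (fromℤ h * seq (w zero) n)) (sum-0* (λ i → seq (w (suc i)) n)))
  (ℚ.+-identityʳ (fromℤ h * seq (w zero) n))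

cone-coordinate : ∀ {m} h (c : Vector ℤ m) w j n →
  Σᵖ (cone h c) w (suc j) n ≡ fromℤ (c j) * seq (w zero) n + seq (w (suc (suc j))) n
cone-coordinate h c w j n = cong (_+_ (fromℤ (c j) * seq (w zero) n)) (begin
  0ℚ * seq (w (suc zero)) n + sum (λ i → fromℤ (basis i j) * seq (w (suc (suc i))) n)
    ≡⟨ cong₂ _+_ (ℚ.*-zeroˡ (seq (w (suc zero)) n))
         (sum-cong-≗ (λ i → cong (λ z → fromℤ z * seq (w (suc (suc i))) n) (basis-sym i j))) ⟩
  0ℚ + sum (λ i → fromℤ (basis j i) * seq (w (suc (suc i))) n)
    ≡⟨ ℚ.+-identityˡ (sum (λ i → fromℤ (basis j i) * seq (w (suc (suc i))) n)) ⟩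
  sum (λ i → fromℤ (basis j i) * seq (w (suc (suc i))) n)
    ≡⟨ sum-basis j (λ i → seq (w (suc (suc i))) n) ⟩
  seq (w (suc (suc j))) n ∎)
  where open ≡-Reasoning

-- The total weight stays as a factor because it is 1 only in the limit, not at each index; the
-- difference is later absorbed by `total`.
translate-sum : ∀ {m k} v (P : Vertices m k) w j n →
  Σᵖ (translate v P) w j n ≡ Σᵖ P w j n + fromℤ (v j) * Σʷ w n
translate-sum v P w j n = begin
  sum (λ i → fromℤ (P i j ℤ.+ v j) * seq (w i) n)
    ≡⟨ sum-cong-≗ (λ i → trans (cong (_* seq (w i) n) (fromℤ-+ (P i j) (v j)))
         (ℚ.*-distribʳ-+ (seq (w i) n) (fromℤ (P i j)) (fromℤ (v j)))) ⟩
  sum (λ i → fromℤ (P i j) * seq (w i) n + fromℤ (v j) * seq (w i) n)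
    ≡⟨ ∑-distrib-+ (λ i → fromℤ (P i j) * seq (w i) n) (λ i → fromℤ (v j) * seq (w i) n) ⟩
  Σᵖ P w j n + sum (λ i → fromℤ (v j) * seq (w i) n)
    ≡⟨ cong (_+_ (Σᵖ P w j n)) (sym (*-distribˡ-sum (fromℤ (v j)) (λ i → seq (w i) n))) ⟩
  Σᵖ P w j n + fromℤ (v j) * Σʷ w n ∎
  where open ≡-Reasoning

-- Signs of the entries of integer vectors with sum -1, 0 or 1

fromℤ-sum : ∀ {m} (d : Vector ℤ m) → fromℤ (sumℤ d) ≡ sum (λ i → fromℤ (d i))
fromℤ-sum {zero}  d = refl
fromℤ-sum {suc m} d = trans (fromℤ-+ (d zero) (sumℤ (d ∘ suc)))
  (cong (_+_ (fromℤ (d zero))) (fromℤ-sum (d ∘ suc)))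

sum-nonpos : ∀ {m} (d : Vector ℤ m) → (∀ i → d i ℤ.≤ + 0) → sumℤ d ℤ.≤ + 0
sum-nonpos {zero}  d d≤0 = ℤ.≤-refl
sum-nonpos {suc m} d d≤0 = ℤ.+-mono-≤ (d≤0 zero) (sum-nonpos (d ∘ suc) (d≤0 ∘ suc))

sum-nonneg : ∀ {m} (d : Vector ℤ m) → (∀ i → + 0 ℤ.≤ d i) → + 0 ℤ.≤ sumℤ d
sum-nonneg {zero}  d 0≤d = ℤ.≤-refl
sum-nonneg {suc m} d 0≤d = ℤ.+-mono-≤ (0≤d zero) (sum-nonneg (d ∘ suc) (0≤d ∘ suc))

≱1⇒≤0 : ∀ {a} → ¬ (+ 1 ℤ.≤ a) → a ℤ.≤ + 0
≱1⇒≤0 ¬1≤a = ℤ.i<j⇒i≤pred[j] (ℤ.≰⇒> ¬1≤a)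

≰-1⇒≥0 : ∀ {a} → ¬ (a ℤ.≤ -[1+ 0 ]) → + 0 ℤ.≤ a
≰-1⇒≥0 ¬a≤-1 = ℤ.i<j⇒suc[i]≤j (ℤ.≰⇒> ¬a≤-1)

positive-term : ∀ {m} (d : Vector ℤ m) → sumℤ d ≡ + 1 → ∃ λ i → + 1 ℤ.≤ d i
positive-term d Σ≡1 with any? (λ i → + 1 ℤ.≤? d i)
... | yes found = found
... | no none   = contradiction (subst (ℤ._≤ + 0) Σ≡1 (sum-nonpos d (λ i → ≱1⇒≤0 (λ p → none (i , p)))))
                    λ { (ℤ.+≤+ ()) }

negative-term : ∀ {m} (d : Vector ℤ m) → sumℤ d ≡ -[1+ 0 ] → ∃ λ i → d i ℤ.≤ -[1+ 0 ]
negative-term d Σ≡-1 with any? (λ i → d i ℤ.≤? -[1+ 0 ])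
... | yes found = found
... | no none   = contradiction (subst (+ 0 ℤ.≤_) Σ≡-1 (sum-nonneg d (λ i → ≰-1⇒≥0 (λ p → none (i , p)))))
                    λ ()

nonpos-zero-sum : ∀ {m} (d : Vector ℤ m) → (∀ i → d i ℤ.≤ + 0) → + 0 ℤ.≤ sumℤ d → ∀ i → d i ≡ + 0
nonpos-zero-sum d d≤0 0≤Σ zero    = ℤ.≤-antisym (d≤0 zero) (ℤ.≤-trans 0≤Σ
  (subst (sumℤ d ℤ.≤_) (ℤ.+-identityʳ (d zero)) (ℤ.+-monoʳ-≤ (d zero) (sum-nonpos (d ∘ suc) (d≤0 ∘ suc)))))
nonpos-zero-sum d d≤0 0≤Σ (suc i) = nonpos-zero-sum (d ∘ suc) (d≤0 ∘ suc) (ℤ.≤-trans 0≤Σ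
  (subst (sumℤ d ℤ.≤_) (ℤ.+-identityˡ (sumℤ (d ∘ suc))) (ℤ.+-monoˡ-≤ (sumℤ (d ∘ suc)) (d≤0 zero)))) i

nonneg-zero-sum : ∀ {m} (d : Vector ℤ m) → (∀ i → + 0 ℤ.≤ d i) → sumℤ d ℤ.≤ + 0 → ∀ i → d i ≡ + 0
nonneg-zero-sum d 0≤d Σ≤0 zero    = ℤ.≤-antisym (ℤ.≤-trans
  (subst (ℤ._≤ sumℤ d) (ℤ.+-identityʳ (d zero)) (ℤ.+-monoʳ-≤ (d zero) (sum-nonneg (d ∘ suc) (0≤d ∘ suc)))) Σ≤0)
  (0≤d zero)
nonneg-zero-sum d 0≤d Σ≤0 (suc i) = nonneg-zero-sum (d ∘ suc) (0≤d ∘ suc) (ℤ.≤-trans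
  (subst (ℤ._≤ sumℤ d) (ℤ.+-identityˡ (sumℤ (d ∘ suc))) (ℤ.+-monoˡ-≤ (sumℤ (d ∘ suc)) (0≤d zero))) Σ≤0) i

-- If entries of one sign are missing, the remaining ones cannot cancel and all vanish.
zero-sum : ∀ {m} (d : Vector ℤ m) → sumℤ d ≡ + 0 →
  (∀ i → d i ≡ + 0) ⊎ (∃ λ i → + 1 ℤ.≤ d i) × (∃ λ i → d i ℤ.≤ -[1+ 0 ])
zero-sum d Σ≡0 with any? (λ i → + 1 ℤ.≤? d i) | any? (λ i → d i ℤ.≤? -[1+ 0 ])
... | yes pos | yes neg = inj₂ (pos , neg)
... | no none | _       = inj₁ (nonpos-zero-sum d (λ i → ≱1⇒≤0 (λ p → none (i , p)))
                            (ℤ.≤-reflexive (sym Σ≡0)))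
... | _       | no none = inj₁ (nonneg-zero-sum d (λ i → ≰-1⇒≥0 (λ p → none (i , p)))
                            (ℤ.≤-reflexive Σ≡0))

2a≢-1 : ∀ a → a ℤ.+ a ≢ -[1+ 0 ]
2a≢-1 (+ a)    ()
2a≢-1 -[1+ a ] ()

weight≤1 : ∀ {m n} {P : Vertices m n} {x w} → Weights P x w → ∀ i → Nonneg (λ n → 1ℚ - seq (w i) n)
weight≤1 {w = w} W i = nonneg-≗ (λ n → regroup (seq (w i) n) (Σʷ w n))
  (nonneg-+ (nonneg-term (weight≥0 W) i) (null-≤ (total W)))
  where
  regroup : ∀ a s → 1ℚ - a ≡ (s - a) + - (s - 1ℚ)
  regroup = solve-∀ ring

-- Intersection of the upper cone with a translate of the lower one, by the height of the
-- translation

module Meeting {m : ℕ} (c : Vector ℤ m) (v : Vector ℤ (suc m)) where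

  P Q : Vertices (suc (suc m)) (suc m)
  P = cone (+ 1) (λ _ → + 0)
  Q = translate v (cone -[1+ 0 ] c)

  module _ {x : Vector ℝ (suc m)} {w u : Vector ℝ (suc (suc m))}
           (W : Weights P x w) (U : Weights Q x u) where

    -- The height of a common point is w₀ read in P and v₀ - u₀ read in Q. Since both weights lie
    -- between 0 and 1, common points exist only for v₀ equal to 0, 1 or 2.
    heights : Null (λ n → seq (w zero) n + seq (u zero) n - fromℤ (v zero))
    heights = null-≗ eq (null-+ (null-+ (point W zero) (null-neg (point U zero)))
      (null-* (fromℤ (v zero)) (total U)))
      where
      regroup : ∀ w u v x S → w + u - v ≡ (1ℚ * w - x) + - ((- 1ℚ * u + v * S) - x) + v * (S - 1ℚ)
      regroup = solve-∀ ring
      eq : ∀ n → seq (w zero) n + seq (u zero) n - fromℤ (v zero) ≡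
        (Σᵖ P w zero n - seq (x zero) n) + - (Σᵖ Q u zero n - seq (x zero) n) +
        fromℤ (v zero) * (Σʷ u n - 1ℚ)
      eq n = trans (regroup (seq (w zero) n) (seq (u zero) n) (fromℤ (v zero)) (seq (x zero) n) (Σʷ u n))
        (cong₂ (λ s t → (s - seq (x zero) n) + - (t - seq (x zero) n) + fromℤ (v zero) * (Σʷ u n - 1ℚ))
          (sym (cone-height (+ 1) (λ _ → + 0) w n))
          (sym (trans (translate-sum v (cone -[1+ 0 ] c) u zero n)
            (cong (_+ fromℤ (v zero) * Σʷ u n) (cone-height -[1+ 0 ] c u n)))))

    coordinates : ∀ j → Null (λ n → seq (w (suc (suc j))) n -
      (seq (u (suc (suc j))) n + fromℤ (c j) * seq (u zero) n + fromℤ (v (suc j))))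
    coordinates j = null-≗ eq (null-+ (null-+ (point W (suc j)) (null-neg (point U (suc j))))
      (null-* (fromℤ (v (suc j))) (total U)))
      where
      regroup : ∀ w₀ w u₀ u c v x S → w - (u + c * u₀ + v) ≡
        ((0ℚ * w₀ + w) - x) + - ((c * u₀ + u + v * S) - x) + v * (S - 1ℚ)
      regroup = solve-∀ ring
      eq : ∀ n → seq (w (suc (suc j))) n -
          (seq (u (suc (suc j))) n + fromℤ (c j) * seq (u zero) n + fromℤ (v (suc j))) ≡
        (Σᵖ P w (suc j) n - seq (x (suc j)) n) + - (Σᵖ Q u (suc j) n - seq (x (suc j)) n) +
        fromℤ (v (suc j)) * (Σʷ u n - 1ℚ)
      eq n = trans (regroup (seq (w zero) n) (seq (w (suc (suc j))) n) (seq (u zero) n)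
          (seq (u (suc (suc j))) n) (fromℤ (c j)) (fromℤ (v (suc j))) (seq (x (suc j)) n) (Σʷ u n))
        (cong₂ (λ s t → (s - seq (x (suc j)) n) + - (t - seq (x (suc j)) n) +
            fromℤ (v (suc j)) * (Σʷ u n - 1ℚ))
          (sym (cone-coordinate (+ 1) (λ _ → + 0) w j n))
          (sym (trans (translate-sum v (cone -[1+ 0 ] c) u (suc j) n)
            (cong (_+ fromℤ (v (suc j)) * Σʷ u n) (cone-coordinate -[1+ 0 ] c u j n)))))

  -- When the apex weights w₀ and u₀ are the integers ω and κ, shift κ ω i is
  -- the difference of the weights of the i-th vertex of the common base.
  shift : ℤ → ℤ → Vector ℤ (suc m)
  shift κ ω zero    = κ ℤ.- ω ℤ.- sumℤ (λ j → κ ℤ.* c j ℤ.+ v (suc j))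
  shift κ ω (suc j) = κ ℤ.* c j ℤ.+ v (suc j)

  -- Both families of weights have total 1, so the base differences balance the apex difference ω -
  -- κ. No coordinate sees the weight of the origin; its entry in `shift` is defined by this
  -- balance.
  sum-shift-weights : ∀ κ ω → sumℤ (shift κ ω) ≡ κ ℤ.- ω
  sum-shift-weights κ ω = cancel (κ ℤ.- ω) (sumℤ (λ j → κ ℤ.* c j ℤ.+ v (suc j)))
    where
    cancel : ∀ a s → (a ℤ.- s) ℤ.+ s ≡ a
    cancel a s = trans (ℤ.+-assoc a (ℤ.- s) s)
      (trans (cong (λ z → a ℤ.+ z) (ℤ.+-inverseˡ s)) (ℤ.+-identityʳ a))

  -- For a basis vector this is `coordinates` with u₀ replaced by its value κ; for the origin it is
  -- the difference of the two totals.
  shift-weights : ∀ κ ω {x w u} → Weights P x w → Weights Q x u →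
    Null (λ n → seq (u zero) n - fromℤ κ) → Null (λ n → seq (w zero) n - fromℤ ω) →
    ∀ i → Null (λ n → seq (w (suc i)) n - seq (u (suc i)) n - fromℤ (shift κ ω i))
  shift-weights κ ω {x} {w} {u} W U u₀≈κ w₀≈ω (suc j) = null-≗
    (λ n → trans (cong (λ z → seq (w (suc (suc j))) n - seq (u (suc (suc j))) n - z)
        (trans (fromℤ-+ (κ ℤ.* c j) (v (suc j))) (cong (_+ fromℤ (v (suc j))) (fromℤ-* κ (c j)))))
      (regroup (seq (w (suc (suc j))) n) (seq (u (suc (suc j))) n) (fromℤ κ) (fromℤ (c j))
        (fromℤ (v (suc j))) (seq (u zero) n)))
    (null-+ (coordinates W U j) (null-* (fromℤ (c j)) u₀≈κ))
    where
    regroup : ∀ w u κ c v u₀ → w - u - (κ * c + v) ≡ (w - (u + c * u₀ + v)) + c * (u₀ - κ)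
    regroup = solve-∀ ring
  shift-weights κ ω {x} {w} {u} W U u₀≈κ w₀≈ω zero = null-≗
    (λ n → trans (cong (λ z → seq (w (suc zero)) n - seq (u (suc zero)) n - z) fromℤ-shift)
      (trans (regroup (seq (w zero) n) (seq (u zero) n) (seq (w (suc zero)) n) (seq (u (suc zero)) n)
          (Σʷ (λ j → w (suc (suc j))) n) (Σʷ (λ j → u (suc (suc j))) n) (fromℤ κ) (fromℤ ω)
          (sum (λ j → fromℤ (shift κ ω (suc j)))))
        (cong (λ t → rest n + - t) (sym (sum-gaps n)))))
    (null-+ (null-+ (null-+ (total W) (null-neg (total U)))
        (null-+ u₀≈κ (null-neg w₀≈ω)))
      (null-neg (null-sum (λ j → shift-weights κ ω W U u₀≈κ w₀≈ω (suc j)))))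
    where
    rest : Seq
    rest n = ((Σʷ w n - 1ℚ) + - (Σʷ u n - 1ℚ)) +
      ((seq (u zero) n - fromℤ κ) + - (seq (w zero) n - fromℤ ω))
    fromℤ-shift : fromℤ (shift κ ω zero) ≡ fromℤ κ + - fromℤ ω + - sum (λ j → fromℤ (shift κ ω (suc j)))
    fromℤ-shift = trans (fromℤ-+ (κ ℤ.- ω) (ℤ.- sumℤ (shift κ ω ∘ suc)))
      (cong₂ _+_ (trans (fromℤ-+ κ (ℤ.- ω)) (cong (_+_ (fromℤ κ)) (fromℤ-neg ω)))
        (trans (fromℤ-neg (sumℤ (shift κ ω ∘ suc))) (cong -_ (fromℤ-sum (shift κ ω ∘ suc)))))
    regroup : ∀ w₀ u₀ w₁ u₁ s t κ ω d → w₁ - u₁ - (κ + - ω + - d) ≡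
      (((w₀ + (w₁ + s)) - 1ℚ) + - ((u₀ + (u₁ + t)) - 1ℚ)) + ((u₀ - κ) + - (w₀ - ω)) + - (s + - t + - d)
    regroup = solve-∀ ring
    sum-gaps : ∀ n → sum (λ j → seq (w (suc (suc j))) n - seq (u (suc (suc j))) n -
        fromℤ (shift κ ω (suc j))) ≡
      Σʷ (λ j → w (suc (suc j))) n + - Σʷ (λ j → u (suc (suc j))) n +
        - sum (λ j → fromℤ (shift κ ω (suc j)))
    sum-gaps n = trans
      (sum-minus (λ j → seq (w (suc (suc j))) n - seq (u (suc (suc j))) n) (λ j → fromℤ (shift κ ω (suc j))))
      (cong (_- sum (λ j → fromℤ (shift κ ω (suc j))))
        (sum-minus (λ j → seq (w (suc (suc j))) n) (λ j → seq (u (suc (suc j))) n)))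

  module _ {κ ω : ℤ} {x : Vector ℝ (suc m)} {w u : Vector ℝ (suc (suc m))} (W : Weights P x w) (U : Weights Q x u)
           (u₀≈κ : Null (λ n → seq (u zero) n - fromℤ κ))
           (w₀≈ω : Null (λ n → seq (w zero) n - fromℤ ω)) {i : Fin (suc m)} where

    -- Here w = u + d with u ≥ 0 and d ≥ 1, so a single base vertex of P carries all the weight;
    -- `negative-shift` is the same with u = w - d.
    positive-shift : + 1 ℤ.≤ shift κ ω i → Nonneg (λ n → seq (w (suc i)) n - 1ℚ)
    positive-shift 1≤d = nonneg-≗
      (λ n → regroup (seq (w (suc i)) n) (seq (u (suc i)) n) (fromℤ (shift κ ω i)))
      (nonneg-+ (nonneg-+ (null-≥ (shift-weights κ ω W U u₀≈κ w₀≈ω i)) (weight≥0 U (suc i)))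
        (nonneg-pointwise (λ _ → 0≤gap (fromℤ-mono-≤ 1≤d))))
      where
      regroup : ∀ w u d → w - 1ℚ ≡ (w - u - d) + u + (d - 1ℚ)
      regroup = solve-∀ ring

    negative-shift : shift κ ω i ℤ.≤ -[1+ 0 ] → Nonneg (λ n → seq (u (suc i)) n - 1ℚ)
    negative-shift d≤-1 = nonneg-≗
      (λ n → regroup (seq (w (suc i)) n) (seq (u (suc i)) n) (fromℤ (shift κ ω i)))
      (nonneg-+ (nonneg-+ (null-≤ (shift-weights κ ω W U u₀≈κ w₀≈ω i)) (weight≥0 W (suc i)))
        (nonneg-pointwise (λ _ → 0≤gap (fromℤ-mono-≤ d≤-1))))
      where
      regroup : ∀ w u d → u - 1ℚ ≡ - (w - u - d) + w + (- 1ℚ - d)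
      regroup = solve-∀ ring

  heights-at : ∀ {k} → v zero ≡ k → ∀ {x w u} → Weights P x w → Weights Q x u →
    Null (λ n → seq (w zero) n + seq (u zero) n - fromℤ k)
  heights-at refl W U = heights W U

  flat : v zero ≡ + 0 → ∀ {x w u} → Weights P x w → Weights Q x u →
    Null (seq (w zero)) × Null (seq (u zero))
  flat v₀≡0 {x} {w} {u} W U =
    null (weight≥0 W zero) (nonneg-≗ (λ n → left (seq (w zero) n) (seq (u zero) n))
      (nonneg-+ (null-≤ (heights-at v₀≡0 W U)) (weight≥0 U zero))) ,
    null (weight≥0 U zero) (nonneg-≗ (λ n → right (seq (w zero) n) (seq (u zero) n))
      (nonneg-+ (null-≤ (heights-at v₀≡0 W U)) (weight≥0 W zero)))
    where
    left : ∀ a b → - a ≡ - (a + b - 0ℚ) + b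
    left = solve-∀ ring
    right : ∀ a b → - b ≡ - (a + b - 0ℚ) + a
    right = solve-∀ ring

  null-0ᶻ : ∀ {s : Seq} → Null s → Null (λ n → s n - fromℤ (+ 0))
  null-0ᶻ {s} = null-≗ (λ n → p-0≡p (s n))

  shared-base : (∀ j → v j ≡ + 0) → BothFacets P Q
  shared-base v≡0 = meet-in-base P Q agree (flat (v≡0 zero))
    where
    agree : ∀ i j → P (suc i) j ≡ Q (suc i) j
    agree i zero    = sym (cong (λ z → + 0 ℤ.+ z) (v≡0 zero))
    agree i (suc j) = sym (trans (cong (λ z → corner i j ℤ.+ z) (v≡0 (suc j))) (ℤ.+-identityʳ (corner i j)))

  -- Common points lie in F and in F + v. The shift is then v with an origin entry making the sum 0:
  -- either v = 0 and the bases coincide, or there are entries of both signs, which pin the point to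
  -- a vertex in each simplex.
  level-0 : v zero ≡ + 0 → BothFaces P Q
  level-0 v₀≡0 = decide (zero-sum (shift (+ 0) (+ 0)) (sum-shift-weights (+ 0) (+ 0)))
    where
    decide : (∀ i → shift (+ 0) (+ 0) i ≡ + 0) ⊎
      (∃ λ i → + 1 ℤ.≤ shift (+ 0) (+ 0) i) × (∃ λ i → shift (+ 0) (+ 0) i ℤ.≤ -[1+ 0 ]) → BothFaces P Q
    decide (inj₁ d≡0) = facets⇒faces {P = P} {Q} (shared-base λ
      { zero → v₀≡0 ; (suc j) → trans (sym (ℤ.+-identityˡ (v (suc j)))) (d≡0 (suc j)) })
    decide (inj₂ ((i , 1≤d) , (i′ , d≤-1))) = meet-in-vertex P Q (suc i) (suc i′) λ W U →
      let (w₀≈0 , u₀≈0) = flat v₀≡0 W U in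
      positive-shift W U (null-0ᶻ u₀≈0) (null-0ᶻ w₀≈0) 1≤d ,
      negative-shift W U (null-0ᶻ u₀≈0) (null-0ᶻ w₀≈0) d≤-1

  -- Two weights that are at most 1 and have sum 2 are both 1, so only the two apexes can meet.
  level-2 : v zero ≡ + 2 → BothFaces P Q
  level-2 v₀≡2 = meet-in-vertex P Q zero zero λ {x} {w} {u} W U →
    nonneg-≗ (λ n → left (seq (w zero) n) (seq (u zero) n))
      (nonneg-+ (null-≥ (heights-at v₀≡2 W U)) (weight≤1 U zero)) ,
    nonneg-≗ (λ n → right (seq (w zero) n) (seq (u zero) n))
      (nonneg-+ (null-≥ (heights-at v₀≡2 W U)) (weight≤1 W zero))
    where
    left : ∀ a b → a - 1ℚ ≡ (a + b - (1ℚ + 1ℚ)) + (1ℚ - b)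
    left = solve-∀ ring
    right : ∀ a b → b - 1ℚ ≡ (a + b - (1ℚ + 1ℚ)) + (1ℚ - a)
    right = solve-∀ ring

  below : ∀ {k} → v zero ≡ -[1+ k ] → BothFaces P Q
  below {k} v₀≡-k = meet-nowhere P Q λ {x} {w} {u} W U → ¬nonneg--1
    (nonneg-≗ (λ n → regroup (seq (w zero) n) (seq (u zero) n) (fromℤ -[1+ k ]))
      (nonneg-+ (nonneg-+ (null-≤ (heights-at v₀≡-k W U)) (nonneg-+ (weight≥0 W zero) (weight≥0 U zero)))
        (nonneg-pointwise (λ _ → 0≤gap (fromℤ-mono-≤ { -[1+ k ]} { -[1+ 0 ]} (ℤ.-≤- ℕ.z≤n))))))
    where
    regroup : ∀ a b k → - 1ℚ ≡ - (a + b - k) + (a + b) + (- 1ℚ - k)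
    regroup = solve-∀ ring

  above : ∀ {k} → v zero ≡ + (suc (suc (suc k))) → BothFaces P Q
  above {k} v₀≡3+k = meet-nowhere P Q λ {x} {w} {u} W U → ¬nonneg--1
    (nonneg-≗ (λ n → regroup (seq (w zero) n) (seq (u zero) n) (fromℤ (+ suc (suc (suc k)))))
      (nonneg-+ (nonneg-+ (null-≥ (heights-at v₀≡3+k W U)) (nonneg-+ (weight≤1 W zero) (weight≤1 U zero)))
        (nonneg-pointwise (λ _ → 0≤gap (fromℤ-mono-≤ {+ 3} {+ suc (suc (suc k))}
          (ℤ.+≤+ (ℕ.s≤s (ℕ.s≤s (ℕ.s≤s ℕ.z≤n)))))))))
    where
    regroup : ∀ a b k → - 1ℚ ≡ (a + b - k) + ((1ℚ - a) + (1ℚ - b)) + (k - (1ℚ + 1ℚ + 1ℚ))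
    regroup = solve-∀ ring

  module _ (v₀≡1 : v zero ≡ + 1) {j l : Fin m} (j≢l : j ≢ l) (cⱼ≡1 : c j ≡ + 1) (cₗ≡1 : c l ≡ + 1) where

    private
      j″ l″ : Fin (suc (suc m))
      j″ = suc (suc j)
      l″ = suc (suc l)

    coordinate : ∀ {x w u i} → c i ≡ + 1 → Weights P x w → Weights Q x u →
      Null (λ n → seq (w (suc (suc i))) n - (seq (u (suc (suc i))) n + 1ℚ * seq (u zero) n + fromℤ (v (suc i))))
    coordinate {w = w} {u} {i} cᵢ≡1 W U = subst (λ z → Null (λ n → seq (w (suc (suc i))) n -
      (seq (u (suc (suc i))) n + fromℤ z * seq (u zero) n + fromℤ (v (suc i))))) cᵢ≡1 (coordinates W U i)

    -- The two entries 1 of c count u₀ twice, while the base weights of P contain it once: 2u₀ ≤ wⱼ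
    -- + wₗ ≤ 1 - w₀ = u₀.
    at-P-apex : + 0 ℤ.≤ v (suc j) ℤ.+ v (suc l) → ∀ {x w u} → Weights P x w → Weights Q x u →
      Null (seq (u zero))
    at-P-apex 0≤v {x} {w} {u} W U = null (weight≥0 U zero) (nonneg-≗
      (λ n → trans (regroup (seq (u zero) n) (seq (w zero) n) (Σʷ (λ i → w (suc i)) n)
          (seq (w j″) n) (seq (w l″) n) (seq (u j″) n) (seq (u l″) n) (fromℤ (v (suc j))) (fromℤ (v (suc l))))
        (cong (λ z → known n + (z - 0ℚ)) (sym (fromℤ-+ (v (suc j)) (v (suc l))))))
      (nonneg-+ (nonneg-+ (nonneg-+ (nonneg-+ (nonneg-+
          (nonneg-pair (λ i → weight≥0 W (suc i)) {suc j} {suc l} (λ { refl → j≢l refl }))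
          (null-≥ (null-+ (coordinate cⱼ≡1 W U) (coordinate cₗ≡1 W U))))
          (nonneg-+ (weight≥0 U j″) (weight≥0 U l″)))
          (null-≤ (total W)))
          (null-≥ (heights-at v₀≡1 W U)))
        (nonneg-pointwise (λ _ → 0≤gap (fromℤ-mono-≤ 0≤v)))))
      where
      known : Seq
      known n = (Σʷ (λ i → w (suc i)) n - (seq (w j″) n + seq (w l″) n)) +
        ((seq (w j″) n - (seq (u j″) n + 1ℚ * seq (u zero) n + fromℤ (v (suc j)))) +
          (seq (w l″) n - (seq (u l″) n + 1ℚ * seq (u zero) n + fromℤ (v (suc l))))) +
        (seq (u j″) n + seq (u l″) n) + - (Σʷ w n - 1ℚ) + (seq (w zero) n + seq (u zero) n - 1ℚ)
      regroup : ∀ u₀ w₀ S wj wl uj ul vj vl → - u₀ ≡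
        (S - (wj + wl)) + ((wj - (uj + 1ℚ * u₀ + vj)) + (wl - (ul + 1ℚ * u₀ + vl))) + (uj + ul) +
        - (w₀ + S - 1ℚ) + (w₀ + u₀ - 1ℚ) + ((vj + vl) - 0ℚ)
      regroup = solve-∀ ring

    -- Dually, 2 - 2u₀ ≤ uⱼ + uₗ ≤ 1 - u₀, which forces u₀ ≥ 1.
    at-Q-apex : v (suc j) ℤ.+ v (suc l) ℤ.≤ -[1+ 1 ] → ∀ {x w u} → Weights P x w → Weights Q x u →
      Null (λ n → seq (u zero) n - fromℤ (+ 1))
    at-Q-apex v≤-2 {x} {w} {u} W U = null
      (nonneg-≗
        (λ n → trans (regroup (seq (u zero) n) (Σʷ (λ i → u (suc i)) n)
            (seq (w j″) n) (seq (w l″) n) (seq (u j″) n) (seq (u l″) n) (fromℤ (v (suc j))) (fromℤ (v (suc l))))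
          (cong (λ z → known n + (fromℤ -[1+ 1 ] - z)) (sym (fromℤ-+ (v (suc j)) (v (suc l))))))
        (nonneg-+ (nonneg-+ (nonneg-+ (nonneg-+
            (nonneg-+ (weight≥0 W j″) (weight≥0 W l″))
            (null-≤ (null-+ (coordinate cⱼ≡1 W U) (coordinate cₗ≡1 W U))))
            (nonneg-pair (λ i → weight≥0 U (suc i)) {suc j} {suc l} (λ { refl → j≢l refl })))
            (null-≤ (total U)))
          (nonneg-pointwise (λ _ → 0≤gap (fromℤ-mono-≤ v≤-2)))))
      (nonneg-≗ (λ n → flip (seq (u zero) n)) (weight≤1 U zero))
      where
      known : Seq
      known n = (seq (w j″) n + seq (w l″) n) +
        - ((seq (w j″) n - (seq (u j″) n + 1ℚ * seq (u zero) n + fromℤ (v (suc j)))) +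
          (seq (w l″) n - (seq (u l″) n + 1ℚ * seq (u zero) n + fromℤ (v (suc l))))) +
        (Σʷ (λ i → u (suc i)) n - (seq (u j″) n + seq (u l″) n)) + - (Σʷ u n - 1ℚ)
      regroup : ∀ u₀ S wj wl uj ul vj vl → u₀ - 1ℚ ≡
        (wj + wl) + - ((wj - (uj + 1ℚ * u₀ + vj)) + (wl - (ul + 1ℚ * u₀ + vl))) +
        (S - (uj + ul)) + - (u₀ + S - 1ℚ) + (- (1ℚ + 1ℚ) - (vj + vl))
      regroup = solve-∀ ring
      flip : ∀ a → - (a - 1ℚ) ≡ 1ℚ - a
      flip = solve-∀ ring

    complementary : ∀ {x w u} → Weights P x w → Weights Q x u → ∀ {κ ω} → κ + ω ≡ 1ℚ →
      Null (λ n → seq (u zero) n - κ) → Null (λ n → seq (w zero) n - ω)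
    complementary {x} {w} {u} W U {κ} {ω} κ+ω≡1 u₀≈κ = null-≗
      (λ n → trans (regroup (seq (w zero) n) (seq (u zero) n) κ ω)
        (cong (λ z → (seq (w zero) n + seq (u zero) n - z) + - (seq (u zero) n - κ)) κ+ω≡1))
      (null-+ (heights-at v₀≡1 W U) (null-neg u₀≈κ))
      where
      regroup : ∀ w u κ ω → w - ω ≡ (w + u - (κ + ω)) + - (u - κ)
      regroup = solve-∀ ring

    -- Once the point is the apex of one simplex, the shift has sum -1 or 1. The entry of that sign
    -- names the only base vertex of the other simplex that the point can be.
    level-1-pair : + 0 ℤ.≤ v (suc j) ℤ.+ v (suc l) ⊎ v (suc j) ℤ.+ v (suc l) ℤ.≤ -[1+ 1 ] → BothFaces P Q
    level-1-pair (inj₁ 0≤v) =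
      let (i , d≤-1) = negative-term (shift (+ 0) (+ 1)) (sum-shift-weights (+ 0) (+ 1)) in
      meet-in-vertex P Q zero (suc i) λ {x} {w} {u} W U →
        let u₀≈0 = null-0ᶻ (at-P-apex 0≤v W U)
            w₀≈1 = complementary W U {fromℤ (+ 0)} {fromℤ (+ 1)} refl u₀≈0
        in null-≥ w₀≈1 , negative-shift {+ 0} {+ 1} W U u₀≈0 w₀≈1 d≤-1
    level-1-pair (inj₂ v≤-2) =
      let (i , 1≤d) = positive-term (shift (+ 1) (+ 0)) (sum-shift-weights (+ 1) (+ 0)) in
      meet-in-vertex P Q (suc i) zero λ {x} {w} {u} W U →
        let u₀≈1 = at-Q-apex v≤-2 W U
            w₀≈0 = complementary W U {fromℤ (+ 1)} {fromℤ (+ 0)} refl u₀≈1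
        in positive-shift {+ 1} {+ 0} W U u₀≈1 w₀≈0 1≤d , null-≥ u₀≈1

-- Every integer except -1; the two alternatives are the two ways in which a pair of coordinates
-- forces an apex.
near-or-far : ℤ → Set
near-or-far a = + 0 ℤ.≤ a ⊎ a ℤ.≤ -[1+ 1 ]

near-or-far? : ∀ a → near-or-far a ⊎ a ≡ -[1+ 0 ]
near-or-far? (+ a)          = inj₁ (inj₁ (ℤ.+≤+ ℕ.z≤n))
near-or-far? -[1+ zero ]    = inj₂ refl
near-or-far? -[1+ (suc a) ] = inj₁ (inj₂ (ℤ.-≤- (ℕ.s≤s ℕ.z≤n)))

-- Three sums equal to -1 would make 2a odd.
some-pair : ∀ a b c → near-or-far (a ℤ.+ b) ⊎ near-or-far (b ℤ.+ c) ⊎ near-or-far (a ℤ.+ c)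
some-pair a b c with near-or-far? (a ℤ.+ b) | near-or-far? (b ℤ.+ c) | near-or-far? (a ℤ.+ c)
... | inj₁ p  | _       | _       = inj₁ p
... | inj₂ _  | inj₁ p  | _       = inj₂ (inj₁ p)
... | inj₂ _  | inj₂ _  | inj₁ p  = inj₂ (inj₂ p)
... | inj₂ ab | inj₂ bc | inj₂ ac = contradiction
  (trans (double a b c) (cong₂ ℤ._+_ (cong₂ ℤ._+_ ab ac) (cong ℤ.-_ bc))) (2a≢-1 a)
  where
  double : ∀ a b c → a ℤ.+ a ≡ (a ℤ.+ b) ℤ.+ (a ℤ.+ c) ℤ.+ ℤ.- (b ℤ.+ c)
  double = solve-∀ ℤ-ring

module _ {m : ℕ} (c : Vector ℤ (suc (suc (suc m))))
  (c₀≡1 : c 0F ≡ + 1) (c₁≡1 : c 1F ≡ + 1) (c₂≡1 : c 2F ≡ + 1) where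

  meet-face-to-face : ∀ v → BothFaces (cone (+ 1) (λ _ → + 0)) (translate v (cone -[1+ 0 ] c))
  meet-face-to-face v = at-level (v zero) refl
    where
    open Meeting c v
    at-level : ∀ k → v zero ≡ k → BothFaces P Q
    at-level -[1+ k ]                  eq = below eq
    at-level (+ 0)                     eq = level-0 eq
    at-level (+ 1)                     eq = choose (some-pair (v 1F) (v 2F) (v 3F))
      where
      choose : near-or-far (v 1F ℤ.+ v 2F) ⊎ near-or-far (v 2F ℤ.+ v 3F) ⊎ near-or-far (v 1F ℤ.+ v 3F) →
        BothFaces P Q
      choose (inj₁ p)        = level-1-pair eq {0F} {1F} (λ ()) c₀≡1 c₁≡1 p
      choose (inj₂ (inj₁ p)) = level-1-pair eq {1F} {2F} (λ ()) c₁≡1 c₂≡1 p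
      choose (inj₂ (inj₂ p)) = level-1-pair eq {0F} {2F} (λ ()) c₀≡1 c₂≡1 p
    at-level (+ 2)                     eq = level-2 eq
    at-level (+ (suc (suc (suc k))))   eq = above eq

-- The common facet, and the distinctness of the simplices

meet-in-facet : ∀ {m} (c : Vector ℤ m) → BothFacets (cone (+ 1) (λ _ → + 0)) (cone -[1+ 0 ] c)
meet-in-facet {m} c = meet-in-base (cone (+ 1) (λ _ → + 0)) (cone -[1+ 0 ] c) agree λ {x} {w} {u} W U →
  -- `flat` speaks of a translate; a translation by 0 is only propositionally the identity, so the
  -- weights are first moved to it.
  flat refl W (unchanged-weights (λ i j → inj₁ (sym (ℤ.+-identityʳ (cone -[1+ 0 ] c i j)))) U)
  where
  open Meeting c (λ _ → + 0) using (flat)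
  agree : ∀ i j → cone (+ 1) (λ _ → + 0) (suc i) j ≡ cone -[1+ 0 ] c (suc i) j
  agree i zero    = refl
  agree i (suc j) = refl

vertex-in-hull : ∀ {m n} (P : Vertices m n) i → convexHull P (λ j → fromℚ (fromℤ (P i j)))
vertex-in-hull {n = n} P i = unit i , convexCombination P p (unit i)
  (unit-weights i (λ j → null-≗ (λ _ → ℚ.+-inverseʳ (fromℤ (P i j))) null-0))
  where
  p : Vector ℝ n
  p j = fromℚ (fromℤ (P i j))

-- The height of a point is -u₀, so height -1 forces the apex weight to be 1.
lowest-point : ∀ {m} (d : Vector ℤ m) {x u} → Null (λ n → seq (x zero) n - - 1ℚ) →
  Weights (cone -[1+ 0 ] d) x u → ∀ j → Null (λ n → fromℤ (d j) - seq (x (suc j)) n)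
lowest-point d {x} {u} x₀≈-1 U j = at-vertex U (others-null U {zero} u₀≥1) (suc j)
  where
  regroup : ∀ u x → u - 1ℚ ≡ - (- 1ℚ * u - x) + - (x - - 1ℚ)
  regroup = solve-∀ ring
  u₀≥1 : Nonneg (λ n → seq (u zero) n - 1ℚ)
  u₀≥1 = nonneg-≗ (λ n → trans (regroup (seq (u zero) n) (seq (x zero) n))
      (cong (λ z → - (z - seq (x zero) n) + - (seq (x zero) n - - 1ℚ)) (sym (cone-height -[1+ 0 ] d u n))))
    (nonneg-+ (null-≤ (point U zero)) (null-≤ x₀≈-1))

-- One inclusion suffices: the apex of the first cone lies in the second at height -1, where only
-- the second apex lies.
apex-injective : ∀ {m} (c d : Vector ℤ m) →
  convexHull (cone -[1+ 0 ] c) ≐ convexHull (cone -[1+ 0 ] d) → ∀ j → c j ≡ d j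
apex-injective {m} c d (c⊆d , _) = lowest (c⊆d {a} (vertex-in-hull (cone -[1+ 0 ] c) zero))
  where
  a : Vector ℝ (suc m)
  a j = fromℚ (fromℤ (cone -[1+ 0 ] c zero j))
  swap : ∀ c d → c - d ≡ - (d - c)
  swap = solve-∀ ring
  lowest : convexHull (cone -[1+ 0 ] d) a → ∀ j → c j ≡ d j
  lowest (u , comb) j = null-const-ℤ {c j} {d j} (null-≗ (λ n → swap (fromℤ (c j)) (fromℤ (d j)))
    (null-neg (lowest-point d {a} {u} (null-≗ (λ _ → ℚ.+-inverseʳ (- 1ℚ)) null-0)
      (weights (cone -[1+ 0 ] d) a u comb) j)))

-- The polynomials xᵐ / m!

ι : ℕ → ℚ
ι k = fromℤ (+ k)

ι-suc : ∀ k → ι (suc k) ≡ 1ℚ + ι k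
ι-suc k = fromℤ-+ (+ 1) (+ k)

0≤ι : ∀ k → 0ℚ ≤ ι k
0≤ι k = fromℤ-mono-≤ {+ 0} {+ k} (ℤ.+≤+ ℕ.z≤n)

0<ι-suc : ∀ k → 0ℚ < ι (suc k)
0<ι-suc k = ℚ.<-≤-trans 0<1 (fromℤ-mono-≤ {+ 1} {+ suc k} (ℤ.+≤+ (ℕ.s≤s ℕ.z≤n)))

-- The reciprocal of k + 1, not of k.
recip : ℕ → ℚ
recip k = 1/⁺ (0<ι-suc k)

0≤recip : ∀ k → 0ℚ ≤ recip k
0≤recip k = ℚ.<⇒≤ (0<1/⁺ (0<ι-suc k))

vol : ℕ → ℚ → ℚ
vol zero    x = 1ℚ
vol (suc m) x = recip m * (x * vol m x)

0≤vol : ∀ m {x} → 0ℚ ≤ x → 0ℚ ≤ vol m x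
0≤vol zero    0≤x = ℚ.<⇒≤ 0<1
0≤vol (suc m) 0≤x = 0≤* (0≤recip m) (0≤* 0≤x (0≤vol m 0≤x))

ι*vol : ∀ m x → ι (suc m) * vol (suc m) x ≡ x * vol m x
ι*vol m x = trans (sym (ℚ.*-assoc (ι (suc m)) (recip m) (x * vol m x)))
  (trans (cong (_* (x * vol m x)) (*-1/⁺ (0<ι-suc m))) (ℚ.*-identityˡ (x * vol m x)))

factorial*vol : ∀ m → ι (m !) * vol m 1ℚ ≡ 1ℚ
factorial*vol zero    = refl
factorial*vol (suc m) = begin
  ι (suc m ℕ.* m !) * (recip m * (1ℚ * vol m 1ℚ))
    ≡⟨ cong (_* (recip m * (1ℚ * vol m 1ℚ)))
         (trans (cong fromℤ (ℤ.pos-* (suc m) (m !))) (fromℤ-* (+ suc m) (+ (m !)))) ⟩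
  ι (suc m) * ι (m !) * (recip m * (1ℚ * vol m 1ℚ))
    ≡⟨ regroup (ι (suc m)) (ι (m !)) (recip m) (vol m 1ℚ) ⟩
  (ι (suc m) * recip m) * (ι (m !) * vol m 1ℚ)
    ≡⟨ cong₂ _*_ (*-1/⁺ (0<ι-suc m)) (factorial*vol m) ⟩
  1ℚ * 1ℚ
    ≡⟨ ℚ.*-identityˡ 1ℚ ⟩
  1ℚ ∎
  where
  open ≡-Reasoning
  regroup : ∀ a b c d → a * b * (c * (1ℚ * d)) ≡ (a * c) * (b * d)
  regroup = solve-∀ ring

-- The mean value theorem for vol (suc m), whose derivative is vol m.

vol-increment-≤ : ∀ m {x y} → 0ℚ ≤ x → x ≤ y →
  0ℚ ≤ (y - x) * vol m y - (vol (suc m) y - vol (suc m) x)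
vol-increment-≤ zero {x} {y} 0≤x x≤y = ℚ.≤-reflexive (sym (trans
  (cong (λ r → (y - x) * 1ℚ - (r * (y * 1ℚ) - r * (x * 1ℚ))) recip0) (cancel x y)))
  where
  recip0 : recip zero ≡ 1ℚ
  recip0 = refl
  cancel : ∀ x y → (y - x) * 1ℚ - (1ℚ * (y * 1ℚ) - 1ℚ * (x * 1ℚ)) ≡ 0ℚ
  cancel = solve-∀ ring
vol-increment-≤ (suc m) {x} {y} 0≤x x≤y = subst (0ℚ ≤_) (sym gap)
  (0≤* (0≤recip (suc m)) (0≤+ (0≤* 0≤x (vol-increment-≤ m 0≤x x≤y))
    (0≤* (0≤* (0≤gap x≤y) (0≤gap x≤y)) (0≤vol m (ℚ.≤-trans 0≤x x≤y)))))
  where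
  open ≡-Reasoning
  r = recip (suc m)
  Vx = vol (suc m) x
  Vy = vol (suc m) y
  vy = vol m y
  expand : ∀ n r x y Vx Vy → ((1ℚ + n) * r) * ((y - x) * Vy) - (r * (y * Vy) - r * (x * Vx)) ≡
    r * ((y - x) * (n * Vy) - x * (Vy - Vx))
  expand = solve-∀ ring
  regroup : ∀ r x y vy Vx Vy → r * ((y - x) * (y * vy) - x * (Vy - Vx)) ≡
    r * (x * ((y - x) * vy - (Vy - Vx)) + (y - x) * (y - x) * vy)
  regroup = solve-∀ ring
  -- Up to the factor 1/(m+2), the new gap is x times the old gap plus (y - x)² `vol m y`, which
  -- closes the induction.
  gap : (y - x) * Vy - (r * (y * Vy) - r * (x * Vx)) ≡
    r * (x * ((y - x) * vy - (Vy - Vx)) + (y - x) * (y - x) * vy)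
  gap = begin
    (y - x) * Vy - (r * (y * Vy) - r * (x * Vx))
      ≡⟨ cong (_- (r * (y * Vy) - r * (x * Vx))) (sym (trans
           (cong (_* ((y - x) * Vy)) (trans (cong (_* r) (sym (ι-suc (suc m)))) (*-1/⁺ (0<ι-suc (suc m)))))
           (ℚ.*-identityˡ ((y - x) * Vy)))) ⟩
    ((1ℚ + ι (suc m)) * r) * ((y - x) * Vy) - (r * (y * Vy) - r * (x * Vx))
      ≡⟨ expand (ι (suc m)) r x y Vx Vy ⟩
    r * ((y - x) * (ι (suc m) * Vy) - x * (Vy - Vx))
      ≡⟨ cong (λ z → r * ((y - x) * z - x * (Vy - Vx))) (ι*vol m y) ⟩
    r * ((y - x) * (y * vy) - x * (Vy - Vx))
      ≡⟨ regroup r x y vy Vx Vy ⟩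
    r * (x * ((y - x) * vy - (Vy - Vx)) + (y - x) * (y - x) * vy) ∎

vol-increment-≥ : ∀ m {x y} → 0ℚ ≤ x → x ≤ y →
  0ℚ ≤ (vol (suc m) y - vol (suc m) x) - (y - x) * vol m x
vol-increment-≥ zero {x} {y} 0≤x x≤y = ℚ.≤-reflexive (sym (trans
  (cong (λ r → (r * (y * 1ℚ) - r * (x * 1ℚ)) - (y - x) * 1ℚ) recip0) (cancel x y)))
  where
  recip0 : recip zero ≡ 1ℚ
  recip0 = refl
  cancel : ∀ x y → (1ℚ * (y * 1ℚ) - 1ℚ * (x * 1ℚ)) - (y - x) * 1ℚ ≡ 0ℚ
  cancel = solve-∀ ring
vol-increment-≥ (suc m) {x} {y} 0≤x x≤y = subst (0ℚ ≤_) (sym gap)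
  (0≤* (0≤recip (suc m)) (0≤+ (0≤* (ℚ.≤-trans 0≤x x≤y) (vol-increment-≥ m 0≤x x≤y))
    (0≤* (0≤* (0≤gap x≤y) (0≤gap x≤y)) (0≤vol m 0≤x))))
  where
  open ≡-Reasoning
  r = recip (suc m)
  Vx = vol (suc m) x
  Vy = vol (suc m) y
  vx = vol m x
  expand : ∀ n r x y Vx Vy → (r * (y * Vy) - r * (x * Vx)) - ((1ℚ + n) * r) * ((y - x) * Vx) ≡
    r * (y * (Vy - Vx) - (y - x) * (n * Vx))
  expand = solve-∀ ring
  regroup : ∀ r x y vx Vx Vy → r * (y * (Vy - Vx) - (y - x) * (x * vx)) ≡
    r * (y * ((Vy - Vx) - (y - x) * vx) + (y - x) * (y - x) * vx)
  regroup = solve-∀ ring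
  gap : (r * (y * Vy) - r * (x * Vx)) - (y - x) * Vx ≡
    r * (y * ((Vy - Vx) - (y - x) * vx) + (y - x) * (y - x) * vx)
  gap = begin
    (r * (y * Vy) - r * (x * Vx)) - (y - x) * Vx
      ≡⟨ cong (λ z → (r * (y * Vy) - r * (x * Vx)) - z) (sym (trans
           (cong (_* ((y - x) * Vx)) (trans (cong (_* r) (sym (ι-suc (suc m)))) (*-1/⁺ (0<ι-suc (suc m)))))
           (ℚ.*-identityˡ ((y - x) * Vx)))) ⟩
    (r * (y * Vy) - r * (x * Vx)) - ((1ℚ + ι (suc m)) * r) * ((y - x) * Vx)
      ≡⟨ expand (ι (suc m)) r x y Vx Vy ⟩
    r * (y * (Vy - Vx) - (y - x) * (ι (suc m) * Vx))
      ≡⟨ cong (λ z → r * (y * (Vy - Vx) - (y - x) * z)) (ι*vol m x) ⟩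
    r * (y * (Vy - Vx) - (y - x) * (x * vx))
      ≡⟨ regroup r x y vx Vx Vy ⟩
    r * (y * ((Vy - Vx) - (y - x) * vx) + (y - x) * (y - x) * vx) ∎

vol-mono : ∀ m {x y} → 0ℚ ≤ x → x ≤ y → vol m x ≤ vol m y
vol-mono zero    0≤x x≤y = ℚ.≤-refl
vol-mono (suc m) {x} {y} 0≤x x≤y = ≤-gap
  (0≤+ (vol-increment-≥ m 0≤x x≤y) (0≤* (0≤gap x≤y) (0≤vol m 0≤x)))
  (regroup (vol (suc m) y - vol (suc m) x) ((y - x) * vol m x))
  where
  regroup : ∀ a b → a ≡ (a - b) + b
  regroup = solve-∀ ring

i≤∣i∣ : ∀ i → i ℤ.≤ + ℤ.∣ i ∣
i≤∣i∣ (+ k)    = ℤ.≤-refl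
i≤∣i∣ -[1+ k ] = ℤ.-≤+

-- The modulus of the numerator is a bound because the denominator is at least 1.
archimedean : ∀ q → ∃ λ N → q ≤ ι N
archimedean q = ℤ.∣ ℚ.↥ q ∣ , ℚ.toℚᵘ-cancel-≤ (ℚᵘ.≤-respʳ-≃
  (ℚᵘ.≃-sym (ℚ.toℚᵘ-fromℚᵘ (ℚᵘ.mkℚᵘ (+ ℤ.∣ ℚ.↥ q ∣) 0))) (ℚᵘ.*≤* (bound q)))
  where
  bound : ∀ q → ℚᵘ.↥ toℚᵘ q ℤ.* + 1 ℤ.≤ + ℤ.∣ ℚ.↥ q ∣ ℤ.* ℚᵘ.↧ toℚᵘ q
  bound q@record{} = ℤ.≤-trans (ℤ.≤-reflexive (ℤ.*-identityʳ (ℚ.↥ q)))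
    (ℤ.≤-trans (i≤∣i∣ (ℚ.↥ q)) (subst (ℤ._≤ + ℤ.∣ ℚ.↥ q ∣ ℤ.* ℚ.↧ q) (ℤ.*-identityʳ (+ ℤ.∣ ℚ.↥ q ∣))
      (ℤ.*-monoˡ-≤-nonNeg (+ ℤ.∣ ℚ.↥ q ∣) (ℤ.+≤+ (ℕ.s≤s ℕ.z≤n)))))

-- Jordan content

module _ {n : ℕ} {p q : ℚ} {x : Vector ℝ n} {j : Fin n} where

  private
    <⇒gap : ∀ {y z} → y ℝ.< z → ∃ λ ε → 0ℚ < ε × Nonneg (λ k → seq z k - (seq y k + ε))
    <⇒gap {y} {z} (ε , 0<ε , le) = ε , 0<ε , ≤⇒nonneg {y ℝ.+ fromℚ ε} {z} le

  -- A common interior point thus makes the height ranges of two slabs overlap, which is how boxes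
  -- of different slabs are shown disjoint.
  between : fromℚ p ℝ.< x j → x j ℝ.< fromℚ q → p < q
  between p<x x<q =
    let (δ , 0<δ , P) = <⇒gap {fromℚ p} {x j} p<x
        (ε , 0<ε , Q) = <⇒gap {x j} {fromℚ q} x<q
        gap = nonneg-const (nonneg-≗ {_} {λ _ → q - (p + (δ + ε))} (λ k → regroup p q δ ε (seq (x j) k))
          (nonneg-+ P Q))
    in ℚ.<-≤-trans (subst (_< p + (δ + ε)) (ℚ.+-identityʳ p) (ℚ.+-monoʳ-< p (ℚ.+-mono-< 0<δ 0<ε)))
         (≤-gap gap refl)
    where
    regroup : ∀ p q δ ε x → q - (p + (δ + ε)) ≡ (x - (p + δ)) + (q - (x + ε))
    regroup = solve-∀ ring

totalVolume-++ : ∀ {n} (as bs : List (Box n)) → totalVolume (as ++ bs) ≡ totalVolume as + totalVolume bs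
totalVolume-++ []       bs = sym (ℚ.+-identityˡ (totalVolume bs))
totalVolume-++ (a ∷ as) bs = trans (cong (_+_ (boxVolume a)) (totalVolume-++ as bs))
  (sym (ℚ.+-assoc (boxVolume a) (totalVolume as) (totalVolume bs)))

-- `HasVolume` restricted to rational values. All volumes below are values of `vol`, so the
-- bookkeeping of errors can stay within the rationals.
record Content {n} (A : Region n) (V : ℚ) : Set where
  field
    inner : ∀ ε → 0ℚ < ε → ∃ λ bs → All (λ b → ∀ x → closure b x → A x) bs ×
      AllPairs InteriorsDisjoint bs × V ≤ totalVolume bs + ε
    outer : ∀ ε → 0ℚ < ε → ∃ λ bs → Covers bs A × totalVolume bs ≤ V + ε

open Content

content-≐ : ∀ {n V} {A B : Region n} → (∀ x → A x → B x) → (∀ x → B x → A x) → Content A V → Content B V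
content-≐ A⊆B B⊆A C = record
  { inner = λ ε 0<ε → let (bs , inside , disjoint , V≤) = inner C ε 0<ε in
      bs , All.map (λ b⊆A x → A⊆B x ∘ b⊆A x) inside , disjoint , V≤
  ; outer = λ ε 0<ε → let (bs , covers , ≤V) = outer C ε 0<ε in
      bs , (λ x → covers x ∘ B⊆A x) , ≤V
  }

hasVolume : ∀ {n V} {A : Region n} → Content A V → HasVolume A (fromℚ V)
hasVolume {n} {V} {A} C =
  (λ ε 0<ε → let (bs , inside , disjoint , V≤) = inner C ε 0<ε in
    bs , All.map (λ b⊆A {x} → b⊆A x) inside , disjoint , fromℚ-mono-≤ V≤) ,
  (λ ε 0<ε → let (bs , covers , ≤V) = outer C ε 0<ε in
    bs , covers , λ δ 0<δ → fromℚ-mono-≤ ≤V δ 0<δ)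

InSlab : ∀ {m} → ℚ → ℚ → Region (suc m)
InSlab l h x = fromℚ l ℝ.≤ x zero × x zero ℝ.≤ fromℚ (l + h)

module _ {m : ℕ} (l : ℚ) {h : ℚ} (0≤h : 0ℚ ≤ h) where

  slabBox : Box m → Box (suc m)
  slabBox b = record
    { lower = l Vector.∷ lower b
    ; upper = (l + h) Vector.∷ upper b
    ; lower≤upper = λ { zero → ≤-gap 0≤h (p+q-p≡q l h) ; (suc j) → lower≤upper b j }
    }

  slabBox-volume : ∀ b → boxVolume (slabBox b) ≡ h * boxVolume b
  slabBox-volume b = cong (_* boxVolume b) (p+q-p≡q l h)

  slabBoxes-volume : ∀ bs → totalVolume (List.map slabBox bs) ≡ h * totalVolume bs
  slabBoxes-volume []       = sym (ℚ.*-zeroʳ h)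
  slabBoxes-volume (b ∷ bs) = trans (cong₂ _+_ (slabBox-volume b) (slabBoxes-volume bs))
    (sym (ℚ.*-distribˡ-+ h (boxVolume b) (totalVolume bs)))

  closure-slabBox : ∀ {b} x → InSlab l h x → closure b (x ∘ suc) → closure (slabBox b) x
  closure-slabBox x x₀∈ x∈b zero    = x₀∈
  closure-slabBox x x₀∈ x∈b (suc j) = x∈b j

-- F is a comparison function whose increments bound the slab volumes h · V k from one side.
-- Stacking the slabs one by one telescopes the increments, at the cost of an error h · ε per slab.
module Slabs {m : ℕ} (A : Region (suc m)) {h : ℚ} (0≤h : 0ℚ ≤ h) (l : ℕ → ℚ)
  (separated : ∀ {i j} → i ℕ.< j → l i + h ≤ l j ⊎ l j + h ≤ l i)
  (C : ℕ → Region m) (V : ℕ → ℚ) (content : ∀ k → Content (C k) (V k)) (F : ℕ → ℚ) where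

  -- Carried through the induction only to separate the boxes of a new slab N from all earlier ones.
  FromSlab : ℕ → Box (suc m) → Set
  FromSlab N b = ∃ λ k → k ℕ.< N × lower b zero ≡ l k × upper b zero ≡ l k + h

  slabs-disjoint : ∀ {N b c} → FromSlab N b → lower c zero ≡ l N → upper c zero ≡ l N + h →
    InteriorsDisjoint c b
  slabs-disjoint {N} {b} {c} (k , k<N , lb , ub) lc uc x (x∈c , x∈b) = impossible (separated k<N)
    where
    lN<lk+h : l N < l k + h
    lN<lk+h = subst₂ _<_ lc ub (between {x = x} {zero} (proj₁ (x∈c zero)) (proj₂ (x∈b zero)))
    lk<lN+h : l k < l N + h
    lk<lN+h = subst₂ _<_ lb uc (between {x = x} {zero} (proj₁ (x∈b zero)) (proj₂ (x∈c zero)))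
    impossible : ¬ (l k + h ≤ l N ⊎ l N + h ≤ l k)
    impossible (inj₁ le) = ℚ.<-irrefl refl (ℚ.<-≤-trans lN<lk+h le)
    impossible (inj₂ le) = ℚ.<-irrefl refl (ℚ.<-≤-trans lk<lN+h le)

  inner-slabs : ∀ N ε → 0ℚ < ε → F zero ≡ 0ℚ → (∀ k → F (suc k) ≤ F k + h * V k) →
    (∀ k → k ℕ.< N → ∀ x → InSlab (l k) h x → C k (x ∘ suc) → A x) →
    ∃ λ bs → All (λ b → ∀ x → closure b x → A x) bs × AllPairs InteriorsDisjoint bs ×
      All (FromSlab N) bs × F N ≤ totalVolume bs + ι N * (h * ε)
  inner-slabs zero    ε 0<ε F₀≡0 F≤ sub = [] , [] , [] , [] ,
    ℚ.≤-reflexive (trans F₀≡0 (zeros (h * ε)))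
    where
    zeros : ∀ a → 0ℚ ≡ 0ℚ + 0ℚ * a
    zeros = solve-∀ ring
  inner-slabs (suc N) ε 0<ε F₀≡0 F≤ sub =
    let (bs , bs⊆C , bs# , V≤) = inner (content N) ε 0<ε
        (cs , cs⊆A , cs# , cs∈ , F≤cs) = inner-slabs N ε 0<ε F₀≡0 F≤ (λ k k<N → sub k (ℕ.m<n⇒m<1+n k<N))
        slab = slabBox (l N) 0≤h
    in List.map slab bs ++ cs ,
       All.++⁺ (All.map⁺ (All.map (λ b⊆C x x∈ → sub N ℕ.≤-refl x (x∈ zero) (b⊆C (x ∘ suc) (x∈ ∘ suc))) bs⊆C))
         cs⊆A ,
       AllPairs.++⁺
         (AllPairs.map⁺ (AllPairs.map (λ b#c x (x∈b , x∈c) → b#c (x ∘ suc) (x∈b ∘ suc , x∈c ∘ suc)) bs#))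
         cs#
         (All.map⁺ (All.universal (λ b → All.map (λ {c} c∈ →
           slabs-disjoint {N} {c} {slabBox (l N) 0≤h b} c∈ refl refl) cs∈) bs)) ,
       All.++⁺ (All.map⁺ (All.universal (λ b → N , ℕ.≤-refl , refl , refl) bs))
         (All.map (λ { (k , k<N , lb , ub) → k , ℕ.m<n⇒m<1+n k<N , lb , ub }) cs∈) ,
       subst (F (suc N) ≤_) (sym (volumes bs cs))
         (≤-gap (0≤+ (0≤+ (0≤gap (F≤ N)) (0≤* 0≤h (0≤gap V≤))) (0≤gap F≤cs))
           (regroup (F (suc N)) (F N) h (V N) (totalVolume bs) (totalVolume cs) (ι N) ε))
    where
    volumes : ∀ bs cs → totalVolume (List.map (slabBox (l N) 0≤h) bs ++ cs) + ι (suc N) * (h * ε) ≡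
      h * totalVolume bs + totalVolume cs + (1ℚ + ι N) * (h * ε)
    volumes bs cs = cong₂ (λ s t → s + t * (h * ε))
      (trans (totalVolume-++ (List.map (slabBox (l N) 0≤h) bs) cs)
        (cong (_+ totalVolume cs) (slabBoxes-volume (l N) 0≤h bs))) (ι-suc N)
    regroup : ∀ F′ F h V b c n ε → (h * b + c + (1ℚ + n) * (h * ε)) - F′ ≡
      (F + h * V - F′) + h * ((b + ε) - V) + ((c + n * (h * ε)) - F)
    regroup = solve-∀ ring

  -- Covering is asserted for a point together with a slab that contains it, since a slab cannot be
  -- computed from the point; `in-some-slab` later supplies one under a double negation.
  outer-slabs : ∀ N ε → 0ℚ < ε → 0ℚ ≤ F zero → (∀ k → F k + h * V k ≤ F (suc k)) →
    (∀ k → k ℕ.< N → ∀ x → A x → InSlab (l k) h x → C k (x ∘ suc)) →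
    ∃ λ bs → (∀ x → A x → ∀ k → k ℕ.< N → InSlab (l k) h x → ¬ All (λ b → ¬ closure b x) bs) ×
      totalVolume bs ≤ F N + ι N * (h * ε)
  outer-slabs zero    ε 0<ε 0≤F ≤F sub = [] , (λ _ _ _ ()) , ≤-gap 0≤F (zeros (F zero) (h * ε))
    where
    zeros : ∀ F a → F + 0ℚ * a - 0ℚ ≡ F
    zeros = solve-∀ ring
  outer-slabs (suc N) ε 0<ε 0≤F ≤F sub =
    let (bs , bs-cover , ≤V) = outer (content N) ε 0<ε
        (cs , cs-cover , cs≤F) = outer-slabs N ε 0<ε 0≤F ≤F (λ k k<N → sub k (ℕ.m<n⇒m<1+n k<N))
    in List.map (slabBox (l N) 0≤h) bs ++ cs ,
       covers bs cs bs-cover cs-cover ,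
       subst₂ _≤_ (sym (volumes bs cs)) (cong (λ z → F (suc N) + z * (h * ε)) (sym (ι-suc N)))
         (≤-gap (0≤+ (0≤+ (0≤gap (≤F N)) (0≤* 0≤h (0≤gap ≤V))) (0≤gap cs≤F))
           (regroup (F (suc N)) (F N) h (V N) (totalVolume bs) (totalVolume cs) (ι N) ε))
    where
    volumes : ∀ bs cs → totalVolume (List.map (slabBox (l N) 0≤h) bs ++ cs) ≡ h * totalVolume bs + totalVolume cs
    volumes bs cs = trans (totalVolume-++ (List.map (slabBox (l N) 0≤h) bs) cs)
      (cong (_+ totalVolume cs) (slabBoxes-volume (l N) 0≤h bs))
    regroup : ∀ F′ F h V b c n ε → (F′ + (1ℚ + n) * (h * ε)) - (h * b + c) ≡
      (F′ - (F + h * V)) + h * ((V + ε) - b) + ((F + n * (h * ε)) - c)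
    regroup = solve-∀ ring
    covers : ∀ bs cs → Covers bs (C N) →
      (∀ x → A x → ∀ k → k ℕ.< N → InSlab (l k) h x → ¬ All (λ b → ¬ closure b x) cs) →
      ∀ x → A x → ∀ k → k ℕ.< suc N → InSlab (l k) h x →
      ¬ All (λ b → ¬ closure b x) (List.map (slabBox (l N) 0≤h) bs ++ cs)
    covers bs cs bs-cover cs-cover x x∈A k k<1+N x₀∈ none = split (ℕ.m<1+n⇒m<n∨m≡n k<1+N)
      where
      split : ¬ (k ℕ.< N ⊎ k ≡ N)
      split (inj₁ k<N)  = cs-cover x x∈A k k<N x₀∈ (All.++⁻ʳ (List.map (slabBox (l N) 0≤h) bs) none)
      split (inj₂ refl) = bs-cover (x ∘ suc) (sub N ℕ.≤-refl x x∈A x₀∈)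
        (All.map (λ {b} ∉ x∈b → ∉ (closure-slabBox (l N) 0≤h {b} x x₀∈ x∈b))
          (All.map⁻ (All.++⁻ˡ (List.map (slabBox (l N) 0≤h) bs) none)))

-- Volumes of tilted cones over a corner

Corner : ∀ {m} → Vector ℚ m → ℚ → Region m
Corner u ρ x = (∀ j → Nonneg (λ n → seq (x j) n - u j)) ×
  Nonneg (λ n → ρ - sum (λ j → seq (x j) n - u j))

-- Distance from the base, positive on the side of the apex. The sign treats S and S_k together,
-- which lie on opposite sides.
depth : Sign → ℚ → ℝ → Seq
depth Sign.+ y₀ y n = seq y n - y₀
depth Sign.- y₀ y n = y₀ - seq y n

-- The section at depth t is the corner of size ρ - t placed at u + t c.
Tilted : ∀ {m} → Sign → ℚ → Vector ℚ m → Vector ℤ m → ℚ → Region (suc m)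
Tilted σ y₀ u c ρ x =
  Nonneg (depth σ y₀ (x zero)) ×
  (∀ j → Nonneg (λ n → seq (x (suc j)) n - u j - fromℤ (c j) * depth σ y₀ (x zero) n)) ×
  Nonneg (λ n → ρ - depth σ y₀ (x zero) n -
    sum (λ j → seq (x (suc j)) n - u j - fromℤ (c j) * depth σ y₀ (x zero) n))

depth-total : ∀ σ y₀ y s → ¬ Nonneg (λ n → depth σ y₀ y n - s) → Nonneg (λ n → s - depth σ y₀ y n)
depth-total Sign.+ y₀ y s ¬p = nonneg-≗ (λ n → regroup₂ (seq y n) y₀ s)
  (nonneg-or-nonpos y (y₀ + s) (¬p ∘ nonneg-≗ (λ n → regroup₁ (seq y n) y₀ s)))
  where
  regroup₁ : ∀ y y₀ s → y - y₀ - s ≡ y - (y₀ + s)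
  regroup₁ = solve-∀ ring
  regroup₂ : ∀ y y₀ s → s - (y - y₀) ≡ y₀ + s - y
  regroup₂ = solve-∀ ring
depth-total Sign.- y₀ y s ¬p = nonneg-≗ (λ n → regroup₂ (seq y n) y₀ s)
  (nonneg-or-nonpos (- 1ℚ ℝ.· y) (s - y₀) (¬p ∘ nonneg-≗ (λ n → regroup₁ (seq y n) y₀ s)))
  where
  regroup₁ : ∀ y y₀ s → y₀ - y - s ≡ - 1ℚ * y - (s - y₀)
  regroup₁ = solve-∀ ring
  regroup₂ : ∀ y y₀ s → s - (y₀ - y) ≡ s - y₀ - - 1ℚ * y
  regroup₂ = solve-∀ ring

-- Lower end, in the height coordinate, of the slab of depths from s to s + h; a negative sign
-- reverses the order, so the deep end is the lower one.
slabBottom : Sign → ℚ → ℚ → ℚ → ℚ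
slabBottom Sign.+ y₀ h s = y₀ + s
slabBottom Sign.- y₀ h s = y₀ - (s + h)

slab⇒depth : ∀ {m} σ y₀ h s (x : Vector ℝ (suc m)) → InSlab (slabBottom σ y₀ h s) h x →
  Nonneg (λ n → depth σ y₀ (x zero) n - s) × Nonneg (λ n → h - (depth σ y₀ (x zero) n - s))
slab⇒depth Sign.+ y₀ h s x (l≤x , x≤u) =
  nonneg-≗ (λ n → lo (seq (x zero) n) y₀ s) (≤⇒nonneg {fromℚ (y₀ + s)} {x zero} l≤x) ,
  nonneg-≗ (λ n → hi (seq (x zero) n) y₀ s h) (≤⇒nonneg {x zero} {fromℚ (y₀ + s + h)} x≤u)
  where
  lo : ∀ y y₀ s → y - y₀ - s ≡ y - (y₀ + s)
  lo = solve-∀ ring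
  hi : ∀ y y₀ s h → h - (y - y₀ - s) ≡ y₀ + s + h - y
  hi = solve-∀ ring
slab⇒depth Sign.- y₀ h s x (l≤x , x≤u) =
  nonneg-≗ (λ n → lo (seq (x zero) n) y₀ s h) (≤⇒nonneg {x zero} {fromℚ (y₀ - (s + h) + h)} x≤u) ,
  nonneg-≗ (λ n → hi (seq (x zero) n) y₀ s h) (≤⇒nonneg {fromℚ (y₀ - (s + h))} {x zero} l≤x)
  where
  lo : ∀ y y₀ s h → y₀ - y - s ≡ y₀ - (s + h) + h - y
  lo = solve-∀ ring
  hi : ∀ y y₀ s h → h - (y₀ - y - s) ≡ y - (y₀ - (s + h))
  hi = solve-∀ ring

depth⇒slab : ∀ {m} σ y₀ h s (x : Vector ℝ (suc m)) → Nonneg (λ n → depth σ y₀ (x zero) n - s) →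
  Nonneg (λ n → h - (depth σ y₀ (x zero) n - s)) → InSlab (slabBottom σ y₀ h s) h x
depth⇒slab Sign.+ y₀ h s x s≤t t≤s+h =
  nonneg⇒≤ {fromℚ (y₀ + s)} {x zero} (nonneg-≗ (λ n → lo (seq (x zero) n) y₀ s) s≤t) ,
  nonneg⇒≤ {x zero} {fromℚ (y₀ + s + h)} (nonneg-≗ (λ n → hi (seq (x zero) n) y₀ s h) t≤s+h)
  where
  lo : ∀ y y₀ s → y - (y₀ + s) ≡ y - y₀ - s
  lo = solve-∀ ring
  hi : ∀ y y₀ s h → y₀ + s + h - y ≡ h - (y - y₀ - s)
  hi = solve-∀ ring
depth⇒slab Sign.- y₀ h s x s≤t t≤s+h =
  nonneg⇒≤ {fromℚ (y₀ - (s + h))} {x zero} (nonneg-≗ (λ n → hi (seq (x zero) n) y₀ s h) t≤s+h) ,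
  nonneg⇒≤ {x zero} {fromℚ (y₀ - (s + h) + h)} (nonneg-≗ (λ n → lo (seq (x zero) n) y₀ s h) s≤t)
  where
  lo : ∀ y y₀ s h → y₀ - (s + h) + h - y ≡ y₀ - y - s
  lo = solve-∀ ring
  hi : ∀ y y₀ s h → y - (y₀ - (s + h)) ≡ h - (y₀ - y - s)
  hi = solve-∀ ring

slabs-separated : ∀ σ y₀ h {s t} → t + h ≤ s →
  slabBottom σ y₀ h s + h ≤ slabBottom σ y₀ h t ⊎ slabBottom σ y₀ h t + h ≤ slabBottom σ y₀ h s
slabs-separated Sign.+ y₀ h {s} {t} t+h≤s = inj₂ (≤-gap (0≤gap t+h≤s) (regroup y₀ h s t))
  where
  regroup : ∀ y₀ h s t → y₀ + s - (y₀ + t + h) ≡ s - (t + h)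
  regroup = solve-∀ ring
slabs-separated Sign.- y₀ h {s} {t} t+h≤s = inj₁ (≤-gap (0≤gap t+h≤s) (regroup y₀ h s t))
  where
  regroup : ∀ y₀ h s t → y₀ - (t + h) - (y₀ - (s + h) + h) ≡ s - (t + h)
  regroup = solve-∀ ring

∣_∣₁ : ∀ {m} → Vector ℤ m → ℕ
∣_∣₁ = Vector.foldr (λ a k → ℤ.∣ a ∣ ℕ.+ k) 0

∣_∣ᶻ : ℤ → ℚ
∣ a ∣ᶻ = ι ℤ.∣ a ∣

sum-∣∣ : ∀ {m} (c : Vector ℤ m) → sum (λ j → ∣ c j ∣ᶻ) ≡ ι ∣ c ∣₁
sum-∣∣ {zero}  c = refl
sum-∣∣ {suc m} c = trans (cong (_+_ ∣ c zero ∣ᶻ) (sum-∣∣ (c ∘ suc)))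
  (sym (fromℤ-+ (+ ℤ.∣ c zero ∣) (+ ∣ c ∘ suc ∣₁)))

0≤∣a∣-a : ∀ a → 0ℚ ≤ ∣ a ∣ᶻ - fromℤ a
0≤∣a∣-a a = 0≤gap (fromℤ-mono-≤ {a} {+ ℤ.∣ a ∣} (i≤∣i∣ a))

0≤∣a∣+a : ∀ a → 0ℚ ≤ ∣ a ∣ᶻ + fromℤ a
0≤∣a∣+a a = subst (0ℚ ≤_) (fromℤ-+ (+ ℤ.∣ a ∣) a) (fromℤ-mono-≤ {+ 0} {+ ℤ.∣ a ∣ ℤ.+ a} (lemma a))
  where
  lemma : ∀ a → + 0 ℤ.≤ + ℤ.∣ a ∣ ℤ.+ a
  lemma (+ k)    = ℤ.+≤+ ℕ.z≤n
  lemma -[1+ k ] = ℤ.≤-reflexive (sym (ℤ.+-inverseʳ (+ suc k)))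

0≤sum : ∀ {m} {a : Fin m → ℚ} → (∀ j → 0ℚ ≤ a j) → 0ℚ ≤ sum a
0≤sum {zero}  0≤a = ℚ.≤-refl
0≤sum {suc m} 0≤a = 0≤+ (0≤a zero) (0≤sum (0≤a ∘ suc))

-- Exchanges the walls at the true depth t for walls frozen at depth s and displaced by g a, keeping
-- the correction in terms of the sums of c and a.
sum-tilt : ∀ {m} (x u c a : Fin m → ℚ) t s g →
  sum (λ j → x j - u j - c j * t) ≡
  sum (λ j → x j - (u j + s * c j + g * a j)) + (s - t) * sum c + g * sum a
sum-tilt {zero}  x u c a t s g = zeros (s - t) g
  where
  zeros : ∀ p g → 0ℚ ≡ 0ℚ + p * 0ℚ + g * 0ℚ
  zeros = solve-∀ ring
sum-tilt {suc m} x u c a t s g = trans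
  (cong (_+_ (x zero - u zero - c zero * t)) (sum-tilt (x ∘ suc) (u ∘ suc) (c ∘ suc) (a ∘ suc) t s g))
  (regroup (x zero) (u zero) (c zero) (a zero) t s g
    (sum (λ j → x (suc j) - (u (suc j) + s * c (suc j) + g * a (suc j)))) (sum (c ∘ suc)) (sum (a ∘ suc)))
  where
  regroup : ∀ x u c a t s g X D C → x - u - c * t + (X + (s - t) * D + g * C) ≡
    (x - (u + s * c + g * a) + X) + (s - t) * (c + D) + g * (a + C)
  regroup = solve-∀ ring

-- It suffices that N + 1 ≥ ρB/ε. Applied with slab thickness ρ/(N+1), it makes any fixed multiple
-- of the thickness small.
fine-mesh : ∀ {ρ B ε} → 0ℚ ≤ ρ → 0ℚ ≤ B → 0ℚ < ε →
  ∃ λ M → ∀ N → M ℕ.≤ N → 0ℚ ≤ ε - ρ * recip N * B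
fine-mesh {ρ} {B} {ε} 0≤ρ 0≤B 0<ε = M , λ N M≤N →
  subst (0ℚ ≤_) (sym (gap N))
    (0≤* (ℚ.<⇒≤ 0<ε) (0≤* (0≤recip N) (0≤gap (ℚ.≤-trans q≤M
      (fromℤ-mono-≤ {+ M} {+ suc N} (ℤ.+≤+ (ℕ.m≤n⇒m≤1+n M≤N)))))))
  where
  q : ℚ
  q = ρ * B * (1/⁺ 0<ε)
  M = proj₁ (archimedean q)
  q≤M : q ≤ ι M
  q≤M = proj₂ (archimedean q)
  regroup : ∀ ε r ρ B e n → ε * (n * r) - (ε * e) * (ρ * r * B) ≡ ε * (r * (n - ρ * B * e))
  regroup = solve-∀ ring
  identity : ∀ a b → a - b ≡ a * 1ℚ - 1ℚ * b
  identity = solve-∀ ring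
  gap : ∀ N → ε - ρ * recip N * B ≡ ε * (recip N * (ι (suc N) - q))
  gap N = trans (identity ε (ρ * recip N * B))
    (trans (cong₂ (λ s t → ε * s - t * (ρ * recip N * B))
        (sym (*-1/⁺ (0<ι-suc N))) (sym (*-1/⁺ 0<ε)))
      (regroup ε (recip N) ρ B (1/⁺ 0<ε) (ι (suc N))))

recip≤1 : ∀ N → 0ℚ ≤ 1ℚ - recip N
recip≤1 N = subst (0ℚ ≤_) (sym gap) (0≤* (0≤ι N) (0≤recip N))
  where
  regroup : ∀ n r → (1ℚ + n) * r - r ≡ n * r
  regroup = solve-∀ ring
  gap : 1ℚ - recip N ≡ ι N * recip N
  gap = trans (cong (_- recip N) (sym (trans (cong (_* recip N) (sym (ι-suc N))) (*-1/⁺ (0<ι-suc N)))))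
    (regroup (ι N) (recip N))

-- The corners of dimension m are a parameter because they are the sections; `corner-content` feeds
-- itself back here to climb one dimension.
module Tilt {m : ℕ} (σ : Sign) (y₀ : ℚ) (u : Vector ℚ m) (c : Vector ℤ m) {ρ : ℚ} (0≤ρ : 0ℚ ≤ ρ)
  (corner-content : ∀ (u : Vector ℚ m) {r} → 0ℚ ≤ r → Content (Corner u r) (vol m r)) where

  A : Region (suc m)
  A = Tilted σ y₀ u c ρ

  C D : ℚ
  C = sum (λ j → ∣ c j ∣ᶻ)
  D = sum (λ j → fromℤ (c j))

  -- A slab of thickness h moves the walls of the cone by at most K h.
  K : ℕ
  K = suc (∣ c ∣₁ ℕ.+ ∣ c ∣₁)

  ιK : ι K ≡ 1ℚ + (C + C)
  ιK = trans (ι-suc (∣ c ∣₁ ℕ.+ ∣ c ∣₁)) (cong (_+_ 1ℚ) (trans (fromℤ-+ (+ ∣ c ∣₁) (+ ∣ c ∣₁))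
    (cong₂ _+_ (sym (sum-∣∣ c)) (sym (sum-∣∣ c)))))

  0≤C : 0ℚ ≤ C
  0≤C = 0≤sum (λ j → 0≤ι ℤ.∣ c j ∣)

  0≤C-D : 0ℚ ≤ C - D
  0≤C-D = subst (0ℚ ≤_) (sum-minus (λ j → ∣ c j ∣ᶻ) (λ j → fromℤ (c j))) (0≤sum (λ j → 0≤∣a∣-a (c j)))

  0≤C+D : 0ℚ ≤ C + D
  0≤C+D = subst (0ℚ ≤_) (∑-distrib-+ (λ j → ∣ c j ∣ᶻ) (λ j → fromℤ (c j))) (0≤sum (λ j → 0≤∣a∣+a (c j)))

  t : Vector ℝ (suc m) → Seq
  t x = depth σ y₀ (x zero)

  -- Within a slab t cⱼ differs from s cⱼ by at most h |cⱼ|. Hence g = h gives walls inside those of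
  -- every section, and g = -h walls outside them.
  wall : ℚ → ℚ → Vector ℚ m
  wall s g j = u j + s * fromℤ (c j) + g * ∣ c j ∣ᶻ

  module _ {s h : ℚ} {x : Vector ℝ (suc m)}
    (s≤t : Nonneg (λ n → t x n - s)) (t≤s+h : Nonneg (λ n → h - (t x n - s))) where

    -- Each inequality of the cone is one of the corner plus nonnegative multiples of the slacks t -
    -- s and h - (t - s); the reserve K h in the size pays for them. `slab-inside` reverses the
    -- argument with the same reserve.
    inside-slab : 0ℚ ≤ s → ∀ r → ρ - s ≡ r + ι K * h → Corner (wall s h) r (x ∘ suc) → A x
    inside-slab 0≤s r ρ-s≡ (walls , roof) =
      nonneg-≗ (λ n → split (t x n) s) (nonneg-+ s≤t (nonneg-pointwise (λ _ → 0≤s))) ,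
      (λ j → nonneg-≗ (λ n → coord (seq (x (suc j)) n) (u j) (fromℤ (c j)) ∣ c j ∣ᶻ (t x n) s h)
        (nonneg-+ (nonneg-+ (walls j) (nonneg-* (0≤ι ℤ.∣ c j ∣) t≤s+h)) (nonneg-* (0≤∣a∣-a (c j)) s≤t))) ,
      nonneg-≗ total-gap
        (nonneg-+ (nonneg-+ (nonneg-+ roof t≤s+h) (nonneg-* 0≤C t≤s+h)) (nonneg-* 0≤C+D s≤t))
      where
      split : ∀ t s → t ≡ (t - s) + s
      split = solve-∀ ring
      coord : ∀ x u c a t s h → x - u - c * t ≡
        (x - (u + s * c + h * a)) + a * (h - (t - s)) + (a - c) * (t - s)
      coord = solve-∀ ring
      X : Seq
      X n = sum (λ j → seq (x (suc j)) n - wall s h j)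
      regroup₁ : ∀ ρ t s X D C h → ρ - t - (X + (s - t) * D + h * C) ≡
        (ρ - s) - (t - s) - X + (t - s) * D - h * C
      regroup₁ = solve-∀ ring
      regroup₂ : ∀ r t s X D C h → r + (1ℚ + (C + C)) * h - (t - s) - X + (t - s) * D - h * C ≡
        (r - X) + (h - (t - s)) + C * (h - (t - s)) + (C + D) * (t - s)
      regroup₂ = solve-∀ ring
      total-gap : ∀ n → ρ - t x n - sum (λ j → seq (x (suc j)) n - u j - fromℤ (c j) * t x n) ≡
        (r - X n) + (h - (t x n - s)) + C * (h - (t x n - s)) + (C + D) * (t x n - s)
      total-gap n = trans (cong (λ z → ρ - t x n - z)
          (sum-tilt (λ j → seq (x (suc j)) n) u (λ j → fromℤ (c j)) (λ j → ∣ c j ∣ᶻ) (t x n) s h))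
        (trans (regroup₁ ρ (t x n) s (X n) D C h)
        (trans (cong (λ z → z - (t x n - s) - X n + (t x n - s) * D - h * C)
            (trans ρ-s≡ (cong (λ z → r + z * h) ιK)))
          (regroup₂ r (t x n) s (X n) D C h)))

    slab-inside : 0ℚ ≤ h → ∀ r → r ≡ (ρ - s) + ι K * h → A x → Corner (wall s (- h)) r (x ∘ suc)
    slab-inside 0≤h r r≡ (_ , walls , roof) =
      (λ j → nonneg-≗ (λ n → coord (seq (x (suc j)) n) (u j) (fromℤ (c j)) ∣ c j ∣ᶻ (t x n) s h)
        (nonneg-+ (nonneg-+ (walls j) (nonneg-* (0≤ι ℤ.∣ c j ∣) t≤s+h)) (nonneg-* (0≤∣a∣+a (c j)) s≤t))) ,
      nonneg-≗ total-gap
        (nonneg-+ (nonneg-+ (nonneg-+ roof (nonneg-+ (nonneg-pointwise (λ _ → 0≤h)) s≤t))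
          (nonneg-* 0≤C t≤s+h)) (nonneg-* 0≤C-D s≤t))
      where
      coord : ∀ x u c a t s h → x - (u + s * c + - h * a) ≡
        (x - u - c * t) + a * (h - (t - s)) + (a + c) * (t - s)
      coord = solve-∀ ring
      X Y : Seq
      X n = sum (λ j → seq (x (suc j)) n - wall s (- h) j)
      Y n = sum (λ j → seq (x (suc j)) n - u j - fromℤ (c j) * t x n)
      regroup₁ : ∀ ρ t s X D C h → (ρ - s) + (1ℚ + (C + C)) * h - X ≡
        (ρ - t - (X + (s - t) * D + - h * C)) + (h + (t - s)) + C * (h - (t - s)) + (C - D) * (t - s)
      regroup₁ = solve-∀ ring
      total-gap : ∀ n → r - X n ≡
        (ρ - t x n - Y n) + (h + (t x n - s)) + C * (h - (t x n - s)) + (C - D) * (t x n - s)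
      total-gap n = trans (cong (_- X n) (trans r≡ (cong (λ z → (ρ - s) + z * h) ιK)))
        (trans (regroup₁ ρ (t x n) s (X n) D C h)
          (cong (λ z → (ρ - t x n - z) + (h + (t x n - s)) + C * (h - (t x n - s)) + (C - D) * (t x n - s))
            (sym (sum-tilt (λ j → seq (x (suc j)) n) u (λ j → fromℤ (c j)) (λ j → ∣ c j ∣ᶻ) (t x n) s (- h)))))

  module Mesh (N : ℕ) where

    h : ℚ
    h = ρ * recip N

    0≤h : 0ℚ ≤ h
    0≤h = 0≤* 0≤ρ (0≤recip N)

    ιN*h : ι (suc N) * h ≡ ρ
    ιN*h = trans (regroup (ι (suc N)) ρ (recip N)) (trans (cong (ρ *_) (*-1/⁺ (0<ι-suc N))) (ℚ.*-identityʳ ρ))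
      where
      regroup : ∀ n ρ r → n * (ρ * r) ≡ ρ * (n * r)
      regroup = solve-∀ ring

    -- Slabs are numbered from the apex, so that the sizes of the sections grow with k and the
    -- telescoping starts at the apex.
    bottom : ℕ → ℚ
    bottom k = ρ - (1ℚ + ι k) * h

    bottom-separated : ∀ {i j} → i ℕ.< j → bottom j + h ≤ bottom i
    bottom-separated {i} {j} i<j = ≤-gap (0≤* (0≤gap 1+i≤j) 0≤h) (regroup ρ h (ι i) (ι j))
      where
      1+i≤j : 1ℚ + ι i ≤ ι j
      1+i≤j = subst (_≤ ι j) (ι-suc i) (fromℤ-mono-≤ {+ suc i} {+ j} (ℤ.+≤+ i<j))
      regroup : ∀ ρ h i j → (ρ - (1ℚ + i) * h) - (ρ - (1ℚ + j) * h + h) ≡ (j - (1ℚ + i)) * h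
      regroup = solve-∀ ring

    separated : ∀ {i j} → i ℕ.< j → slabBottom σ y₀ h (bottom i) + h ≤ slabBottom σ y₀ h (bottom j) ⊎
      slabBottom σ y₀ h (bottom j) + h ≤ slabBottom σ y₀ h (bottom i)
    separated i<j = slabs-separated σ y₀ h (bottom-separated i<j)

    0≤bottom : ∀ {k} → k ℕ.< suc N → 0ℚ ≤ bottom k
    0≤bottom {k} k<N = subst (0ℚ ≤_) (trans (regroup (ι (suc N)) (ι k) h) (cong (_- (1ℚ + ι k) * h) ιN*h))
      (0≤* (0≤gap 1+k≤N) 0≤h)
      where
      1+k≤N : 1ℚ + ι k ≤ ι (suc N)
      1+k≤N = subst (_≤ ι (suc N)) (ι-suc k) (fromℤ-mono-≤ {+ suc k} {+ suc N} (ℤ.+≤+ k<N))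
      regroup : ∀ n k h → (n - (1ℚ + k)) * h ≡ n * h - (1ℚ + k) * h
      regroup = solve-∀ ring

    ρ-bottom : ∀ k → ρ - bottom k ≡ (1ℚ + ι k) * h
    ρ-bottom k = regroup ρ ((1ℚ + ι k) * h)
      where
      regroup : ∀ a b → a - (a - b) ≡ b
      regroup = solve-∀ ring

    -- A point outside slab k whose depth is at most ρ - k h cannot have depth at least ρ - (k+1) h,
    -- so it is pushed one slab towards the base. After N steps only the last slab remains, and
    -- depth at least 0 puts the point there.
    in-some-slab : ∀ x → A x → ¬ (∀ k → k ℕ.< suc N → ¬ InSlab (slabBottom σ y₀ h (bottom k)) h x)
    in-some-slab x (0≤t , walls , roof) none = none N ℕ.≤-refl
      (depth⇒slab σ y₀ h (bottom N) x
        (nonneg-≗ (λ n → cong (λ z → t x n - z) bottom-N) (nonneg-≗ (λ n → p-0≡p (t x n)) 0≤t))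
        (nonneg-≗ (λ n → last (t x n) ρ (ι N) h) (descend N ℕ.≤-refl)))
      where
      bottom-N : bottom N ≡ 0ℚ
      bottom-N = trans (cong (λ z → ρ - z * h) (sym (ι-suc N))) (trans (cong (λ z → ρ - z) ιN*h) (ℚ.+-inverseʳ ρ))
      last : ∀ t ρ n h → h - (t - (ρ - (1ℚ + n) * h)) ≡ ρ - n * h - t
      last = solve-∀ ring
      start : ∀ t ρ h X → ρ - 0ℚ * h - t ≡ (ρ - t - X) + X
      start = solve-∀ ring
      descend : ∀ k → k ℕ.≤ N → Nonneg (λ n → ρ - ι k * h - t x n)
      descend zero    k≤N = nonneg-≗
        (λ n → start (t x n) ρ h (sum (λ j → seq (x (suc j)) n - u j - fromℤ (c j) * t x n)))
        (nonneg-+ roof (nonneg-sum walls))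
      descend (suc k) k<N = nonneg-≗ (λ n → cong (λ z → ρ - z * h - t x n) (ι-suc k))
        (depth-total σ y₀ (x zero) (bottom k) λ bottom≤t →
          none k (ℕ.m<n⇒m<1+n k<N) (depth⇒slab σ y₀ h (bottom k) x bottom≤t
            (nonneg-≗ (λ n → last (t x n) ρ (ι k) h) (descend k (ℕ.<⇒≤ k<N)))))

  -- The error allowed in each slab: half of the total error is spread over the
  -- height ρ, and the denominator 1 + ρ covers ρ = 0.
  slabError : ℚ → ℚ
  slabError ε = (½ * ε) * (1/⁺ (ℚ.+-mono-<-≤ 0<1 0≤ρ))

  0<slabError : ∀ {ε} → 0ℚ < ε → 0ℚ < slabError ε
  0<slabError 0<ε = 0<* (0<½* 0<ε) (0<1/⁺ (ℚ.+-mono-<-≤ 0<1 0≤ρ))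

  ρ*slabError : ∀ ε → ½ * ε - ρ * slabError ε ≡ slabError ε
  ρ*slabError ε = trans (regroup (½ * ε) r ρ)
    (trans (cong (λ s → (½ * ε - ½ * ε * s) + ½ * ε * r) (*-1/⁺ 0<1+ρ)) (cancel (½ * ε) (½ * ε * r)))
    where
    0<1+ρ : 0ℚ < 1ℚ + ρ
    0<1+ρ = ℚ.+-mono-<-≤ 0<1 0≤ρ
    r = 1/⁺ 0<1+ρ
    regroup : ∀ e r ρ → e - ρ * (e * r) ≡ (e - (e * ((1ℚ + ρ) * r))) + e * r
    regroup = solve-∀ ring
    cancel : ∀ e b → (e - e * 1ℚ) + b ≡ b
    cancel = solve-∀ ring

  inner-boxes : ∀ ε → 0ℚ < ε → ∃ λ bs → All (λ b → ∀ x → closure b x → A x) bs ×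
    AllPairs InteriorsDisjoint bs × vol (suc m) ρ ≤ totalVolume bs + ε
  inner-boxes ε 0<ε =
    let (bs , inside , disjoint , _ , F≤) = inner-slabs M δ 0<δ F-zero F-suc contained
    in bs , inside , disjoint , ≤-gap (0≤+ (0≤+ (0≤+ (0≤gap F≤) approach) mesh-small) total-δ)
         (regroup (totalVolume bs) ε (vol (suc m) ρ) (vol (suc m) (ι M * h)) (ι M * (h * δ)) (ι K * h * vol m ρ))
    where
    δ : ℚ
    δ = slabError ε
    0<δ : 0ℚ < δ
    0<δ = 0<slabError 0<ε
    mesh = fine-mesh 0≤ρ (0≤* (0≤ι K) (0≤vol m 0≤ρ)) (0<½* 0<ε)
    -- The K slabs nearest the apex are dropped: slab K + k holds a corner of size (k+1) h, whereas
    -- before slab K the reserve K h leaves no positive size. The M slabs kept reach size ρ - K h,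
    -- and the loss is at most K h `vol m ρ`, below ε/2 by the mesh.
    M N : ℕ
    M = suc (proj₁ mesh)
    N = K ℕ.+ proj₁ mesh
    open Mesh N
    N+1 : suc N ≡ K ℕ.+ M
    N+1 = sym (ℕ.+-suc K (proj₁ mesh))
    size : ℕ → ℚ
    size k = (1ℚ + ι k) * h
    0≤size : ∀ k → 0ℚ ≤ size k
    0≤size k = 0≤* (0≤+ (ℚ.<⇒≤ 0<1) (0≤ι k)) 0≤h
    F : ℕ → ℚ
    F k = vol (suc m) (ι k * h)
    open Slabs A 0≤h (λ k → slabBottom σ y₀ h (bottom (K ℕ.+ k)))
      (λ i<j → separated (ℕ.+-monoʳ-< K i<j))
      (λ k → Corner (wall (bottom (K ℕ.+ k)) h) (size k)) (λ k → vol m (size k))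
      (λ k → corner-content (wall (bottom (K ℕ.+ k)) h) (0≤size k)) F
    F-zero : F zero ≡ 0ℚ
    F-zero = zeros (recip m) h (vol m (0ℚ * h))
      where
      zeros : ∀ r h v → r * ((0ℚ * h) * v) ≡ 0ℚ
      zeros = solve-∀ ring
    F-suc : ∀ k → F (suc k) ≤ F k + h * vol m (size k)
    F-suc k = ≤-gap (vol-increment-≤ m (0≤* (0≤ι k) 0≤h)
        (≤-gap {ι k * h} {size k} 0≤h (step (ι k) h)))
      (trans (cong (λ z → F k + h * vol m (size k) - vol (suc m) (z * h)) (ι-suc k))
        (gap (F k) (vol m (size k)) (vol (suc m) (size k)) (ι k) h))
      where
      step : ∀ k h → (1ℚ + k) * h - k * h ≡ h
      step = solve-∀ ring
      gap : ∀ F v F′ k h → F + h * v - F′ ≡ ((1ℚ + k) * h - k * h) * v - (F′ - F)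
      gap = solve-∀ ring
    contained : ∀ k → k ℕ.< M → ∀ x → InSlab (slabBottom σ y₀ h (bottom (K ℕ.+ k))) h x →
      Corner (wall (bottom (K ℕ.+ k)) h) (size k) (x ∘ suc) → A x
    contained k k<M x x₀∈ =
      let (s≤t , t≤s+h) = slab⇒depth σ y₀ h (bottom (K ℕ.+ k)) x x₀∈
      in inside-slab {bottom (K ℕ.+ k)} {h} {x} s≤t t≤s+h
           (0≤bottom (subst (K ℕ.+ k ℕ.<_) (sym N+1) (ℕ.+-monoʳ-< K k<M))) (size k)
           (trans (ρ-bottom (K ℕ.+ k)) (trans (cong (λ z → (1ℚ + z) * h) (fromℤ-+ (+ K) (+ k)))
             (regroup′ (ι K) (ι k) h)))
      where
      regroup′ : ∀ K k h → (1ℚ + (K + k)) * h ≡ (1ℚ + k) * h + K * h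
      regroup′ = solve-∀ ring
    ρ-split : ρ ≡ ι M * h + ι K * h
    ρ-split = trans (sym ιN*h) (trans (cong (λ z → ι z * h) N+1)
      (trans (cong (_* h) (fromℤ-+ (+ K) (+ M))) (distrib (ι K) (ι M) h)))
      where
      distrib : ∀ K M h → (K + M) * h ≡ M * h + K * h
      distrib = solve-∀ ring
    ρ-Mh : ρ - ι M * h ≡ ι K * h
    ρ-Mh = trans (cong (_- ι M * h) ρ-split) (p+q-p≡q (ι M * h) (ι K * h))
    approach : 0ℚ ≤ ι K * h * vol m ρ - (vol (suc m) ρ - vol (suc m) (ι M * h))
    approach = subst (λ z → 0ℚ ≤ z * vol m ρ - (vol (suc m) ρ - vol (suc m) (ι M * h))) ρ-Mh
      (vol-increment-≤ m (0≤* (0≤ι M) 0≤h) (≤-gap {ι M * h} {ρ} (0≤* (0≤ι K) 0≤h) ρ-Mh))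
    mesh-small : 0ℚ ≤ ½ * ε - ι K * h * vol m ρ
    mesh-small = subst (λ z → 0ℚ ≤ ½ * ε - z) (regroup′ h (ι K) (vol m ρ))
      (proj₂ mesh N (ℕ.m≤n+m (proj₁ mesh) K))
      where
      regroup′ : ∀ h K v → h * (K * v) ≡ K * h * v
      regroup′ = solve-∀ ring
    total-δ : 0ℚ ≤ ½ * ε - ι M * (h * δ)
    total-δ = subst (0ℚ ≤_) (sym gap)
      (0≤+ (0≤* (0≤* (0≤ι K) 0≤h) (ℚ.<⇒≤ 0<δ)) (ℚ.<⇒≤ 0<δ))
      where
      regroup′ : ∀ e ρ M h δ → e - M * (h * δ) ≡ (ρ - M * h) * δ + (e - ρ * δ)
      regroup′ = solve-∀ ring
      gap : ½ * ε - ι M * (h * δ) ≡ ι K * h * δ + δ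
      gap = trans (regroup′ (½ * ε) ρ (ι M) h δ) (cong₂ (λ p q → p * δ + q) ρ-Mh (ρ*slabError ε))
    regroup : ∀ b ε V F n p → (b + ε) - V ≡ (b + n - F) + (p - (V - F)) + (½ * ε - p) + (½ * ε - n)
    regroup b ε V F n p = trans (cong (λ z → (b + z) - V) (sym (½p+½p≡p ε))) (regroup′ b (½ * ε) V F n p)
      where
      regroup′ : ∀ b e V F n p → (b + (e + e)) - V ≡ (b + n - F) + (p - (V - F)) + (e - p) + (e - n)
      regroup′ = solve-∀ ring

  outer-boxes : ∀ ε → 0ℚ < ε → ∃ λ bs → Covers bs A × totalVolume bs ≤ vol (suc m) ρ + ε
  outer-boxes ε 0<ε =
    let (bs , covers , ≤F) = outer-slabs (suc N) δ 0<δ (0≤vol (suc m) (0≤size zero)) F-suc contained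
    in bs , (λ x x∈A none → in-some-slab x x∈A (λ k k<N x₀∈ → covers x x∈A k k<N x₀∈ none)) ,
       ≤-gap (0≤+ (0≤+ (0≤+ (0≤gap ≤F) approach) mesh-small) total-δ)
         (regroup (totalVolume bs) ε (vol (suc m) ρ) (F (suc N)) (ι (suc N) * (h * δ)) (κ * vol m (ρ + κ)) (κ * V′))
    where
    δ : ℚ
    δ = slabError ε
    0<δ : 0ℚ < δ
    0<δ = 0<slabError 0<ε
    0≤1+K : 0ℚ ≤ 1ℚ + ι K
    0≤1+K = 0≤+ (ℚ.<⇒≤ 0<1) (0≤ι K)
    -- The mesh must be chosen before κ is known. Since h ≤ ρ for every mesh, κ is at most (1 + K)
    -- ρ, and this value bounds the slope `vol m (ρ + κ)` in advance.
    V′ : ℚ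
    V′ = vol m (ρ + (1ℚ + ι K) * ρ)
    0≤V′ : 0ℚ ≤ V′
    0≤V′ = 0≤vol m (0≤+ 0≤ρ (0≤* 0≤1+K 0≤ρ))
    mesh = fine-mesh 0≤ρ (0≤* 0≤1+K 0≤V′) (0<½* 0<ε)
    N : ℕ
    N = proj₁ mesh
    open Mesh N
    κ : ℚ
    κ = (1ℚ + ι K) * h
    0≤κ : 0ℚ ≤ κ
    0≤κ = 0≤* 0≤1+K 0≤h
    size : ℕ → ℚ
    size k = (1ℚ + ι k + ι K) * h
    0≤size : ∀ k → 0ℚ ≤ size k
    0≤size k = 0≤* (0≤+ (0≤+ (ℚ.<⇒≤ 0<1) (0≤ι k)) (0≤ι K)) 0≤h
    F : ℕ → ℚ
    F k = vol (suc m) (size k)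
    open Slabs A 0≤h (λ k → slabBottom σ y₀ h (bottom k)) separated
      (λ k → Corner (wall (bottom k) (- h)) (size k)) (λ k → vol m (size k))
      (λ k → corner-content (wall (bottom k) (- h)) (0≤size k)) F
    size-suc : ∀ k → size (suc k) - size k ≡ h
    size-suc k = trans (cong (λ z → (1ℚ + z + ι K) * h - size k) (ι-suc k)) (step (ι k) (ι K) h)
      where
      step : ∀ k K h → (1ℚ + (1ℚ + k) + K) * h - (1ℚ + k + K) * h ≡ h
      step = solve-∀ ring
    F-suc : ∀ k → F k + h * vol m (size k) ≤ F (suc k)
    F-suc k = ≤-gap (vol-increment-≥ m (0≤size k) (≤-gap {size k} {size (suc k)} 0≤h (size-suc k)))
      (trans (gap (F (suc k)) (F k) h (vol m (size k)))
        (cong (λ z → (F (suc k) - F k) - z * vol m (size k)) (sym (size-suc k))))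
      where
      gap : ∀ F′ F h v → F′ - (F + h * v) ≡ (F′ - F) - h * v
      gap = solve-∀ ring
    contained : ∀ k → k ℕ.< suc N → ∀ x → A x → InSlab (slabBottom σ y₀ h (bottom k)) h x →
      Corner (wall (bottom k) (- h)) (size k) (x ∘ suc)
    contained k _ x x∈A x₀∈ =
      let (s≤t , t≤s+h) = slab⇒depth σ y₀ h (bottom k) x x₀∈
      in slab-inside {bottom k} {h} {x} s≤t t≤s+h 0≤h (size k)
           (trans (distrib (ι k) (ι K) h) (cong (_+ ι K * h) (sym (ρ-bottom k)))) x∈A
      where
      distrib : ∀ k K h → (1ℚ + k + K) * h ≡ (1ℚ + k) * h + K * h
      distrib = solve-∀ ring
    size-N : size (suc N) ≡ ρ + κ
    size-N = trans (distrib (ι (suc N)) (ι K) h) (cong (_+ κ) ιN*h)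
      where
      distrib : ∀ n K h → (1ℚ + n + K) * h ≡ n * h + (1ℚ + K) * h
      distrib = solve-∀ ring
    κ≤ : 0ℚ ≤ (1ℚ + ι K) * ρ - κ
    κ≤ = subst (0ℚ ≤_) (regroup′ (1ℚ + ι K) ρ (recip N)) (0≤* (0≤* 0≤1+K 0≤ρ) (recip≤1 N))
      where
      regroup′ : ∀ a ρ r → a * ρ * (1ℚ - r) ≡ a * ρ - a * (ρ * r)
      regroup′ = solve-∀ ring
    approach : 0ℚ ≤ κ * vol m (ρ + κ) - (F (suc N) - vol (suc m) ρ)
    approach = subst₂ (λ z f → 0ℚ ≤ z * vol m (ρ + κ) - (vol (suc m) f - vol (suc m) ρ))
      (p+q-p≡q ρ κ) (sym size-N)
      (vol-increment-≤ m 0≤ρ (≤-gap {ρ} {ρ + κ} 0≤κ (p+q-p≡q ρ κ)))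
    mesh-small : 0ℚ ≤ (κ * V′ - κ * vol m (ρ + κ)) + (½ * ε - κ * V′)
    mesh-small = 0≤+
      (subst (0ℚ ≤_) (distrib κ V′ (vol m (ρ + κ))) (0≤* 0≤κ
        (0≤gap (vol-mono m (0≤+ 0≤ρ 0≤κ) (ℚ.+-monoʳ-≤ ρ (≤-gap {κ} {(1ℚ + ι K) * ρ} κ≤ refl))))))
      (subst (λ z → 0ℚ ≤ ½ * ε - z) (regroup′ h (1ℚ + ι K) V′) (proj₂ mesh N ℕ.≤-refl))
      where
      distrib : ∀ a b c → a * (b - c) ≡ a * b - a * c
      distrib = solve-∀ ring
      regroup′ : ∀ h a v → h * (a * v) ≡ a * h * v
      regroup′ = solve-∀ ring
    total-δ : 0ℚ ≤ ½ * ε - ι (suc N) * (h * δ)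
    total-δ = subst (0ℚ ≤_) (sym (trans
      (cong (λ z → ½ * ε - z) (trans (sym (ℚ.*-assoc (ι (suc N)) h δ)) (cong (_* δ) ιN*h)))
      (ρ*slabError ε))) (ℚ.<⇒≤ 0<δ)
    regroup : ∀ b ε V F n p q → (V + ε) - b ≡
      (F + n - b) + (p - (F - V)) + ((q - p) + (½ * ε - q)) + (½ * ε - n)
    regroup b ε V F n p q = trans (cong (λ z → (V + z) - b) (sym (½p+½p≡p ε))) (regroup′ b (½ * ε) V F n p q)
      where
      regroup′ : ∀ b e V F n p q → (V + (e + e)) - b ≡
        (F + n - b) + (p - (F - V)) + ((q - p) + (e - q)) + (e - n)
      regroup′ = solve-∀ ring

  tilted-content : Content (Tilted σ y₀ u c ρ) (vol (suc m) ρ)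
  tilted-content = record { inner = inner-boxes ; outer = outer-boxes }

-- Induction on the dimension: a corner is the tilted cone with tilt 0 over a corner of one
-- dimension less. In dimension 0 the only box has the empty product 1 as its volume.
corner-content : ∀ {m} (u : Vector ℚ m) {r} → 0ℚ ≤ r → Content (Corner u r) (vol m r)
corner-content {zero} u {r} 0≤r = record
  { inner = λ ε 0<ε → point-box ∷ [] ,
      ((λ x _ → (λ ()) , nonneg-≗ {t = λ _ → r - 0ℚ} (λ _ → p-0≡p r) (nonneg-pointwise (λ _ → 0≤r))) ∷ []) ,
      ([] ∷ []) , ≤-gap {1ℚ} {1ℚ + 0ℚ + ε} (ℚ.<⇒≤ 0<ε) (cancel ε)
  ; outer = λ ε 0<ε → point-box ∷ [] ,
      (λ { x _ (x∉ ∷ []) → x∉ (λ ()) }) , ≤-gap {1ℚ + 0ℚ} {1ℚ + ε} (ℚ.<⇒≤ 0<ε) (cancel′ ε)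
  }
  where
  point-box : Box 0
  point-box = record { lower = λ () ; upper = λ () ; lower≤upper = λ () }
  cancel : ∀ ε → 1ℚ + 0ℚ + ε - 1ℚ ≡ ε
  cancel = solve-∀ ring
  cancel′ : ∀ ε → 1ℚ + ε - (1ℚ + 0ℚ) ≡ ε
  cancel′ = solve-∀ ring
corner-content {suc m} u {r} 0≤r = content-≐
  (λ { x (0≤t , walls , roof) →
    (λ { zero    → 0≤t
       ; (suc j) → nonneg-≗ (λ n → sym (untilt (gap x (suc j) n) (gap x zero n))) (walls j) }) ,
    nonneg-≗ (λ n → trans (regroup r (gap x zero n) (sum (λ j → gap x (suc j) n)))
      (cong (λ z → r - gap x zero n - z) (sym (untilt-sum x n)))) roof })
  (λ { x (walls , roof) →
    walls zero ,
    (λ j → nonneg-≗ (λ n → untilt (gap x (suc j) n) (gap x zero n)) (walls (suc j))) ,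
    nonneg-≗ (λ n → trans (cong (λ z → r - gap x zero n - z) (untilt-sum x n))
      (sym (regroup r (gap x zero n) (sum (λ j → gap x (suc j) n))))) roof })
  (Tilt.tilted-content Sign.+ (u zero) (u ∘ suc) (λ _ → + 0) 0≤r corner-content)
  where
  gap : Vector ℝ (suc m) → Fin (suc m) → Seq
  gap x j n = seq (x j) n - u j
  untilt : ∀ a t → a - 0ℚ * t ≡ a
  untilt = solve-∀ ring
  untilt-sum : ∀ x n → sum (λ j → gap x (suc j) n - 0ℚ * gap x zero n) ≡ sum (λ j → gap x (suc j) n)
  untilt-sum x n = sum-cong-≗ (λ j → untilt (gap x (suc j) n) (gap x zero n))
  regroup : ∀ r a s → r - (a + s) ≡ r - a - s
  regroup = solve-∀ ring

-- Unimodularity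

height : Sign → ℤ
height Sign.+ = + 1
height Sign.- = -[1+ 0 ]

height² : ∀ σ → fromℤ (height σ) * fromℤ (height σ) ≡ 1ℚ
height² Sign.+ = refl
height² Sign.- = refl

depth-height : ∀ σ y n → depth σ 0ℚ y n ≡ fromℤ (height σ) * seq y n
depth-height Sign.+ y n = identity (seq y n)
  where
  identity : ∀ a → a - 0ℚ ≡ 1ℚ * a
  identity = solve-∀ ring
depth-height Sign.- y n = negate (seq y n)
  where
  negate : ∀ a → 0ℚ - a ≡ - 1ℚ * a
  negate = solve-∀ ring

module _ {m : ℕ} (σ : Sign) (c : Vector ℤ m) where

  private
    e : ℚ
    e = fromℤ (height σ)

    P : Vertices (suc (suc m)) (suc m)
    P = cone (height σ) c

    K : Region (suc m)
    K = Tilted σ 0ℚ (λ _ → 0ℚ) c 1ℚ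

  module _ {x : Vector ℝ (suc m)} where

    private
      t : Seq
      t = depth σ 0ℚ (x zero)
      y : Fin m → Seq
      y j n = seq (x (suc j)) n - 0ℚ - fromℤ (c j) * t n

    -- The inequalities of the tilted cone are the barycentric coordinates: depth is the apex
    -- weight, distances to the walls are the weights of the basis vectors, and the slack of the
    -- roof is the weight of the origin.
    hull⇒tilted : ∀ {w} → Weights P x w → K x
    hull⇒tilted {w} W =
      nonneg-≗ (λ n → split (t n) (w₀ n)) (nonneg-+ (null-≥ t≈w₀) (weight≥0 W zero)) ,
      (λ j → nonneg-≗ (λ n → split (y j n) (seq (w (suc (suc j))) n))
        (nonneg-+ (null-≥ (y≈w j)) (weight≥0 W (suc (suc j))))) ,
      nonneg-≗ (λ n → trans (regroup (t n) (w₀ n) (seq (w (suc zero)) n) (sum (λ j → y j n))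
          (Σʷ (λ j → w (suc (suc j))) n))
          (cong (λ z → seq (w (suc zero)) n + - (Σʷ w n - 1ℚ) + - (t n - w₀ n) + - z)
            (sym (sum-minus (λ j → y j n) (λ j → seq (w (suc (suc j))) n)))))
        (nonneg-+ (nonneg-+ (nonneg-+ (weight≥0 W (suc zero)) (null-≤ (total W))) (null-≤ t≈w₀))
          (null-≤ (null-sum y≈w)))
      where
      w₀ : Seq
      w₀ = seq (w zero)
      split : ∀ a b → a ≡ (a - b) + b
      split = solve-∀ ring
      regroup : ∀ t w₀ w₁ Y S → 1ℚ - t - Y ≡
        w₁ + - ((w₀ + (w₁ + S)) - 1ℚ) + - (t - w₀) + - (Y - S)
      regroup = solve-∀ ring
      t≈w₀ : Null (λ n → t n - w₀ n)
      t≈w₀ = null-≗ (λ n → trans (cong (_- w₀ n) (depth-height σ (x zero) n))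
          (trans (expand e (seq (x zero) n) (w₀ n)) (trans
            (cong (λ z → - e * (e * w₀ n - seq (x zero) n) + (z * w₀ n - w₀ n)) (height² σ))
            (trans (cancel (- e * (e * w₀ n - seq (x zero) n)) (w₀ n))
              (cong (λ z → - e * (z - seq (x zero) n)) (sym (cone-height (height σ) c w n)))))))
        (null-* (- e) (point W zero))
        where
        expand : ∀ e x w → e * x - w ≡ - e * (e * w - x) + (e * e * w - w)
        expand = solve-∀ ring
        cancel : ∀ a w → a + (1ℚ * w - w) ≡ a
        cancel = solve-∀ ring
      y≈w : ∀ j → Null (λ n → y j n - seq (w (suc (suc j))) n)
      y≈w j = null-≗ (λ n → trans (expand (seq (x (suc j)) n) (fromℤ (c j)) (t n) (w₀ n) (seq (w (suc (suc j))) n))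
          (cong (λ z → - (z - seq (x (suc j)) n) + - fromℤ (c j) * (t n - w₀ n))
            (sym (cone-coordinate (height σ) c w j n))))
        (null-+ (null-neg (point W (suc j))) (null-* (- fromℤ (c j)) t≈w₀))
        where
        expand : ∀ x c t w₀ w → x - 0ℚ - c * t - w ≡ - (c * w₀ + w - x) + - c * (t - w₀)
        expand = solve-∀ ring

    -- Solves the triangular system for the weights: the height gives the apex as e² = 1, the other
    -- coordinates give the basis vectors, and the origin takes the remainder.
    tilted-weights : Vector ℝ (suc (suc m))
    tilted-weights zero          = e ℝ.· x zero
    tilted-weights (suc zero)    = 1ℝ ℝ.+ - 1ℚ ℝ.·
      (e ℝ.· x zero ℝ.+ ℝ.sum (λ j → x (suc j) ℝ.+ (- fromℤ (c j) * e) ℝ.· x zero))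
    tilted-weights (suc (suc j)) = x (suc j) ℝ.+ (- fromℤ (c j) * e) ℝ.· x zero

    tilted⇒hull : K x → Weights P x tilted-weights
    tilted⇒hull (0≤t , walls , roof) = record
      { weight≥0 = λ
        { zero          → nonneg-≗ (λ n → sym (depth-height σ (x zero) n)) 0≤t
        ; (suc zero)    → nonneg-≗ (λ n → trans
            (cong₂ (λ s r → 1ℚ + - 1ℚ * (s + r)) (sym (depth-height σ (x zero) n))
              (trans (seq-sum (λ j → tilted-weights (suc (suc j))) n)
                (sum-cong-≗ (λ j → tilted-weight j n))))
            (regroup (t n) (sum (λ j → y j n)))) roof
        ; (suc (suc j)) → nonneg-≗ (tilted-weight j) (walls j) }
      ; total = null-≗ (λ n → trans
          (cong (λ z → e * seq (x zero) n + ((1ℚ + - 1ℚ * (e * seq (x zero) n + z)) + S n) - 1ℚ)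
            (seq-sum (λ j → tilted-weights (suc (suc j))) n))
          (cancel (e * seq (x zero) n) (S n))) null-0
      ; point = λ
        { zero    → null-≗ (λ n → trans (cong (_- seq (x zero) n)
            (trans (cone-height (height σ) c tilted-weights n) (trans
              (sym (ℚ.*-assoc e e (seq (x zero) n)))
              (trans (cong (_* seq (x zero) n) (height² σ)) (ℚ.*-identityˡ (seq (x zero) n))))))
            (ℚ.+-inverseʳ (seq (x zero) n))) null-0
        ; (suc j) → null-≗ (λ n → trans (cong (_- seq (x (suc j)) n)
            (cone-coordinate (height σ) c tilted-weights j n))
            (coord (fromℤ (c j)) e (seq (x zero) n) (seq (x (suc j)) n))) null-0 }
      }
      where
      S : Seq
      S = Σʷ (λ j → tilted-weights (suc (suc j)))
      regroup : ∀ t Y → 1ℚ + - 1ℚ * (t + Y) ≡ 1ℚ - t - Y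
      regroup = solve-∀ ring
      cancel : ∀ w S → w + ((1ℚ + - 1ℚ * (w + S)) + S) - 1ℚ ≡ 0ℚ
      cancel = solve-∀ ring
      coord : ∀ c e x₀ x → c * (e * x₀) + (x + (- c * e) * x₀) - x ≡ 0ℚ
      coord = solve-∀ ring
      tilted-weight : ∀ j n → seq (tilted-weights (suc (suc j))) n ≡ y j n
      tilted-weight j n = trans (expand (seq (x (suc j)) n) (fromℤ (c j)) e (seq (x zero) n))
        (cong (λ z → seq (x (suc j)) n - 0ℚ - fromℤ (c j) * z) (sym (depth-height σ (x zero) n)))
        where
        expand : ∀ x c e x₀ → x + (- c * e) * x₀ ≡ x - 0ℚ - c * (e * x₀)
        expand = solve-∀ ring

  cone-content : Content (convexHull P) (vol (suc m) 1ℚ)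
  cone-content = content-≐
    (λ x x∈K → tilted-weights {x} , convexCombination P x (tilted-weights {x}) (tilted⇒hull {x} x∈K))
    (λ { x (w , comb) → hull⇒tilted {x} {w} (weights P x w comb) })
    (Tilt.tilted-content σ 0ℚ (λ _ → 0ℚ) c (ℚ.<⇒≤ 0<1) corner-content)

  -- The same triangular order: height kills the apex coefficient, the coordinates those of the
  -- basis vectors, and the total that of the origin.
  cone-independent : AffinelyIndependent P
  cone-independent d Σd≈0 Pd≈0 = vanish
    where
    sum≈0 : Null (Σʷ d)
    sum≈0 = null-≗ (λ n → sym (seq-sum d n)) (≈0⇒null {ℝ.sum d} Σd≈0)
    comb≈0 : ∀ j → Null (Σᵖ P d j)
    comb≈0 j = null-≗ (λ n → sym (seq-combination P d j n)) (≈0⇒null {combination P d j} (Pd≈0 j))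
    d₀≈0 : Null (seq (d zero))
    d₀≈0 = null-≗ (λ n → trans (sym (trans (sym (ℚ.*-assoc e e (seq (d zero) n)))
        (trans (cong (_* seq (d zero) n) (height² σ)) (ℚ.*-identityˡ (seq (d zero) n)))))
        (cong (e *_) (sym (cone-height (height σ) c d n))))
      (null-* e (comb≈0 zero))
    dⱼ≈0 : ∀ j → Null (seq (d (suc (suc j))))
    dⱼ≈0 j = null-≗ (λ n → trans (regroup (fromℤ (c j)) (seq (d zero) n) (seq (d (suc (suc j))) n))
        (cong (λ z → z + - fromℤ (c j) * seq (d zero) n) (sym (cone-coordinate (height σ) c d j n))))
      (null-+ (comb≈0 (suc j)) (null-* (- fromℤ (c j)) d₀≈0))
      where
      regroup : ∀ c a b → b ≡ c * a + b + - c * a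
      regroup = solve-∀ ring
    vanish : ∀ i → d i ℝ.≈ 0ℝ
    vanish zero          = null⇒≈0 {d zero} d₀≈0
    vanish (suc zero)    = null⇒≈0 {d (suc zero)} (null-≗
      (λ n → regroup (seq (d zero) n) (seq (d (suc zero)) n) (Σʷ (λ j → d (suc (suc j))) n))
      (null-+ (null-+ sum≈0 (null-neg d₀≈0)) (null-neg (null-sum dⱼ≈0))))
      where
      regroup : ∀ a b s → b ≡ (a + (b + s)) + - a + - s
      regroup = solve-∀ ring
    vanish (suc (suc j)) = null⇒≈0 {d (suc (suc j))} (dⱼ≈0 j)

  cone-unimodular : ∀ h → height σ ≡ h → IsUnimodularSimplex (cone h c)
  cone-unimodular _ refl = cone-independent , fromℚ V , hasVolume cone-content ,
    null⇒≈ {fromℤ (+ (suc m !)) ℝ.· fromℚ V} {fromℚ (fromℤ (+ 1))} (null-≗ (λ _ → gap) null-0)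
    where
    V : ℚ
    V = vol (suc m) 1ℚ
    gap : fromℤ (+ (suc m !)) * V - fromℤ (+ 1) ≡ 0ℚ
    gap = trans (cong (λ z → z - fromℤ (+ 1)) (factorial*vol (suc m))) (ℚ.+-inverseʳ 1ℚ)

-- The infinite family

apex : ∀ {o} → ℕ → Vector ℤ (suc (suc (suc (suc o))))
apex k 0F                        = + 1
apex k 1F                        = + 1
apex k 2F                        = + 1
apex k 3F                        = + k
apex k (suc (suc (suc (suc j)))) = + 0

theorem6p1 : ∀ (n : ℕ) → n ≥ 5 →
    ∃ λ (S : Vertices (suc n) n) → ∃ λ (T : ℕ → Vertices (suc n) n) →
    IsUnimodularSimplex S ×
    (∀ k → IsUnimodularSimplex (T k)) ×
    (∀ k l → k ≢ l → ¬ (convexHull (T k) ≐ convexHull (T l))) ×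
    (∀ k → IsFacet S (convexHull S ∩ convexHull (T k)) ×
    IsFacet (T k) (convexHull S ∩ convexHull (T k))) ×
    (∀ k (v : Vector ℤ n) →
    IsFace S (convexHull S ∩ convexHull (translate v (T k))) ×
    IsFace (translate v (T k)) (convexHull S ∩ convexHull (translate v (T k))))
theorem6p1 (suc (suc (suc (suc (suc o))))) (ℕ.s≤s (ℕ.s≤s (ℕ.s≤s (ℕ.s≤s (ℕ.s≤s ℕ.z≤n))))) =
  cone {suc (suc (suc (suc o)))} (+ 1) (λ _ → + 0) ,
  (λ k → cone {suc (suc (suc (suc o)))} -[1+ 0 ] (apex {o} k)) ,
  cone-unimodular {suc (suc (suc (suc o)))} Sign.+ (λ _ → + 0) (+ 1) refl ,
  (λ k → cone-unimodular {suc (suc (suc (suc o)))} Sign.- (apex {o} k) -[1+ 0 ] refl) ,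
  -- Equal hulls have equal apexes, and the entry at `3F` is the one that holds k.
  (λ k l k≢l same → k≢l (ℤ.+-injective
    (apex-injective {suc (suc (suc (suc o)))} (apex {o} k) (apex {o} l) same 3F))) ,
  (λ k → meet-in-facet {suc (suc (suc (suc o)))} (apex {o} k)) ,
  (λ k → meet-face-to-face {suc o} (apex {o} k) refl refl refl)
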